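{- Let $n \geq 1$ be an integer and let $q = 2^n$. Let $\mathrm{AGL}(2,q^2)$ be the affine group of pairs $(a,A)$ with $a \in \mathbb{F}_{q^2}^2$, $A \in \mathrm{GL}_2(\mathbb{F}_{q^2})$ and multiplication $(a,A)(b,B) = (a+Ab,AB)$, and let $$H_q = \{(b,\mathrm{I}_2) \in \mathrm{AGL}(2,q^2) \mid b \in \mathbb{F}_q^2\},$$ where $\mathbb{F}_q^2 \subseteq \mathbb{F}_{q^2}^2$ denotes the set of column vectors with both entries in the subfield $\mathbb{F}_q$ of $\mathbb{F}_{q^2}$. Then $H_q$ is a non-normal subgroup of $\mathrm{AGL}(2,q^2)$ which is a perfect code of $\mathrm{AGL}(2,q^2)$, but the property $\Phi(\mathrm{AGL}(2,q^2),H_q)$ does not hold.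
   Context: $\mathrm{I}_2$ is the $2\times 2$ identity matrix. The identity element of $\mathrm{AGL}(2,q^2)$ is $(0,\mathrm{I}_2)$. For a finite group $G$ with identity $e$ and a subset $S \subseteq G \setminus \{e\}$ that is inverse-closed (i.e. $x \in S$ implies $x^{ -1}\in S$), the Cayley graph $\mathrm{Cay}(G,S)$ is the simple graph with vertex set $G$ in which $g,h \in G$ are adjacent if and only if $hg^{ -1} \in S$. A subset $C$ of the vertex set of a graph $X$ is a perfect code of $X$ if $C$ is a coclique (independent set) of $X$ and every vertex of $X$ not in $C$ is adjacent to exactly one vertex in $C$. A subset (in particular, a subgroup) $C$ of a finite group $G$ is a perfect code of $G$ if there exists an inverse-closed subset $S \subseteq G\setminus\{e\}$ such that $C$ is a perfect code of $\mathrm{Cay}(G,S)$. For a finite group $G$ with identity $e$ and a subgroup $H \leq G$, the property $\Phi(G,H)$ is the statement: for all $g \in G$, if $g^2 \in H$ then there exists $h \in H$ such that $(gh)^2 = e$. -}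

module Defs where

open import Algebra.Bundles using (CommutativeRing; Group)
open import Data.Fin.Base using (Fin)
open import Data.Nat.Base using (ℕ)
open import Data.Product using (∃!; ∃-syntax; Σ; _×_; _,_; proj₁; proj₂)
open import Function.Bundles using (Bijection)
open import Level using (Level; _⊔_) renaming (suc to lsuc)
open import Relation.Binary.Bundles using (Setoid)
open import Relation.Binary.Definitions using (_Respects_; _Respects₂_; Irreflexive; Symmetric)
open import Relation.Binary.Core using (Rel)
import Relation.Binary.Construct.On as On
import Relation.Binary.PropositionalEquality as ≡
import Relation.Binary.Reasoning.Setoid as SetoidReasoning
open import Relation.Nullary.Negation using (¬_)
open import Relation.Unary using (Pred; _∈_; _∉_)
import Algebra.Definitions as AlgebraDefinitions
import Algebra.Properties.Group as GroupProperties
import Algebra.Properties.Ring as RingProperties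
import Algebra.Solver.Ring.NaturalCoefficients.Default as Solver

private
  variable
    c ℓ k p r s : Level

HasOrder : Setoid c ℓ → ℕ → Set (c ⊔ ℓ)
HasOrder S m = Bijection (≡.setoid (Fin m)) S

-- Elements of a subset are compared in the ambient setoid; membership
-- proofs are ignored.
subsetoid : (S : Setoid c ℓ) → Pred (Setoid.Carrier S) p → Setoid (c ⊔ p) ℓ
subsetoid S P = On.setoid {B = Σ (Setoid.Carrier S) P} S proj₁

record SimpleGraph c ℓ r : Set (lsuc (c ⊔ ℓ ⊔ r)) where
  field
    vertices : Setoid c ℓ
  open Setoid vertices public using (_≈_) renaming (Carrier to Vertex)
  field
    Adj      : Rel Vertex r
    Adj-resp : Adj Respects₂ _≈_
    Adj-sym  : Symmetric Adj
    Adj-irr  : Irreflexive _≈_ Adj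

record IsPerfectCode (X : SimpleGraph c ℓ r) (C : Pred (SimpleGraph.Vertex X) p)
                     : Set (c ⊔ ℓ ⊔ r ⊔ p) where
  open SimpleGraph X
  field
    coclique  : ∀ {u v} → u ∈ C → v ∈ C → ¬ Adj u v
    dominates : ∀ v → v ∉ C → ∃! _≈_ λ u → u ∈ C × Adj v u

module _ (G : Group c ℓ) where
  open Group G

  record IsSubgroup (H : Pred Carrier p) : Set (c ⊔ ℓ ⊔ p) where
    field
      resp      : H Respects _≈_
      ε-closed  : ε ∈ H
      ∙-closed  : ∀ {x y} → x ∈ H → y ∈ H → x ∙ y ∈ H
      ⁻¹-closed : ∀ {x} → x ∈ H → x ⁻¹ ∈ H

  IsNormal : Pred Carrier p → Set (c ⊔ p)
  IsNormal H = ∀ g {h} → h ∈ H → (g ∙ h) ∙ g ⁻¹ ∈ H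

  record IsConnectionSet (S : Pred Carrier s) : Set (c ⊔ ℓ ⊔ s) where
    field
      resp           : S Respects _≈_
      ε-free         : ε ∉ S
      inverse-closed : ∀ {x} → x ∈ S → x ⁻¹ ∈ S

  Cay : (S : Pred Carrier s) → IsConnectionSet S → SimpleGraph c ℓ s
  Cay S isConn = record
    { vertices = setoid
    ; Adj      = λ g h → h ∙ g ⁻¹ ∈ S
    ; Adj-resp = (λ y≈z → resp (∙-congʳ y≈z))
               , (λ y≈z → resp (∙-congˡ (⁻¹-cong y≈z)))
    ; Adj-sym  = λ {g} {h} hg⁻¹∈S → resp (flip-quotient g h) (inverse-closed hg⁻¹∈S)
    ; Adj-irr  = λ {g} {h} g≈h hg⁻¹∈S →
        ε-free (resp (trans (∙-congʳ (sym g≈h)) (inverseʳ g)) hg⁻¹∈S)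
    }
    where
    open IsConnectionSet isConn
    open GroupProperties G using (⁻¹-anti-homo-∙; ⁻¹-involutive)

    flip-quotient : ∀ g h → (h ∙ g ⁻¹) ⁻¹ ≈ g ∙ h ⁻¹
    flip-quotient g h = trans (⁻¹-anti-homo-∙ h (g ⁻¹)) (∙-congʳ (⁻¹-involutive g))

  IsPerfectCodeOfGroup : Pred Carrier p → Set (lsuc (c ⊔ ℓ) ⊔ p)
  IsPerfectCodeOfGroup C =
    Σ (Pred Carrier (c ⊔ ℓ)) λ S → Σ (IsConnectionSet S) λ isConn →
      IsPerfectCode (Cay S isConn) C

  Φ : Pred Carrier p → Set (c ⊔ ℓ ⊔ p)
  Φ H = ∀ g → g ∙ g ∈ H → ∃[ h ] (h ∈ H × (g ∙ h) ∙ (g ∙ h) ≈ ε)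

record Field c ℓ : Set (lsuc (c ⊔ ℓ)) where
  field
    commutativeRing : CommutativeRing c ℓ
  open CommutativeRing commutativeRing public
  open AlgebraDefinitions _≈_ using (Invertible)
  field
    0≉1        : ¬ (0# ≈ 1#)
    invertible : ∀ {x} → ¬ (x ≈ 0#) → Invertible 1# _*_ x

module _ (F : Field c ℓ) where
  open Field F

  record IsSubfield (K : Pred Carrier k) : Set (c ⊔ ℓ ⊔ k) where
    field
      resp        : K Respects _≈_
      0-closed    : 0# ∈ K
      1-closed    : 1# ∈ K
      +-closed    : ∀ {x y} → x ∈ K → y ∈ K → x + y ∈ K
      neg-closed  : ∀ {x} → x ∈ K → - x ∈ K
      *-closed    : ∀ {x y} → x ∈ K → y ∈ K → x * y ∈ K
      inv-closed  : ∀ {x y} → x ∈ K → x * y ≈ 1# → y ∈ K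

module Affine (F : Field c ℓ) where
  open Field F
  open Solver commutativeSemiring using (solve; _:=_; _:+_; _:*_; con)
  open RingProperties ring using (-‿distribʳ-*; -‿+-comm)

  infix  4 _≈ᵛ_ _≈ᵐ_
  infixl 6 _+ᵛ_
  infixl 7 _·_ _·ᵛ_

  record Vec₂ : Set c where
    constructor vec
    field
      x₁ x₂ : Carrier

  record _≈ᵛ_ (u v : Vec₂) : Set ℓ where
    constructor vec-≈
    private
      module u = Vec₂ u
      module v = Vec₂ v
    field
      x₁ : u.x₁ ≈ v.x₁
      x₂ : u.x₂ ≈ v.x₂

  _+ᵛ_ : Vec₂ → Vec₂ → Vec₂
  vec a b +ᵛ vec a′ b′ = vec (a + a′) (b + b′)

  -ᵛ_ : Vec₂ → Vec₂
  -ᵛ vec a b = vec (- a) (- b)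

  0ᵛ : Vec₂
  0ᵛ = vec 0# 0#

  -- Entries are listed row by row.
  record Mat₂ : Set c where
    constructor mat
    field
      m₁₁ m₁₂ m₂₁ m₂₂ : Carrier

  record _≈ᵐ_ (A B : Mat₂) : Set ℓ where
    constructor mat-≈
    private
      module A = Mat₂ A
      module B = Mat₂ B
    field
      m₁₁ : A.m₁₁ ≈ B.m₁₁
      m₁₂ : A.m₁₂ ≈ B.m₁₂
      m₂₁ : A.m₂₁ ≈ B.m₂₁
      m₂₂ : A.m₂₂ ≈ B.m₂₂

  I₂ : Mat₂
  I₂ = mat 1# 0#
           0# 1#

  _·_ : Mat₂ → Mat₂ → Mat₂
  mat a b c d · mat a′ b′ c′ d′ =
    mat (a * a′ + b * c′) (a * b′ + b * d′)
        (c * a′ + d * c′) (c * b′ + d * d′)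

  _·ᵛ_ : Mat₂ → Vec₂ → Vec₂
  mat a b c d ·ᵛ vec x y = vec (a * x + b * y) (c * x + d * y)

  ≈ᵛ-refl : ∀ {u} → u ≈ᵛ u
  ≈ᵛ-refl = vec-≈ refl refl

  ≈ᵛ-sym : ∀ {u v} → u ≈ᵛ v → v ≈ᵛ u
  ≈ᵛ-sym (vec-≈ p q) = vec-≈ (sym p) (sym q)

  ≈ᵛ-trans : ∀ {u v w} → u ≈ᵛ v → v ≈ᵛ w → u ≈ᵛ w
  ≈ᵛ-trans (vec-≈ p q) (vec-≈ p′ q′) = vec-≈ (trans p p′) (trans q q′)

  ≈ᵐ-refl : ∀ {A} → A ≈ᵐ A
  ≈ᵐ-refl = mat-≈ refl refl refl refl

  ≈ᵐ-sym : ∀ {A B} → A ≈ᵐ B → B ≈ᵐ A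
  ≈ᵐ-sym (mat-≈ p q r s) = mat-≈ (sym p) (sym q) (sym r) (sym s)

  ≈ᵐ-trans : ∀ {A B C} → A ≈ᵐ B → B ≈ᵐ C → A ≈ᵐ C
  ≈ᵐ-trans (mat-≈ p q r s) (mat-≈ p′ q′ r′ s′) =
    mat-≈ (trans p p′) (trans q q′) (trans r r′) (trans s s′)

  lin : ∀ {a a′ x x′ b b′ y y′} → a ≈ a′ → x ≈ x′ → b ≈ b′ → y ≈ y′ →
        a * x + b * y ≈ a′ * x′ + b′ * y′
  lin p q r s = +-cong (*-cong p q) (*-cong r s)

  lin-1-0 : ∀ x y → 1# * x + 0# * y ≈ x
  lin-1-0 = solve 2 (λ x y → con 1 :* x :+ con 0 :* y := x) refl

  lin-0-1 : ∀ x y → 0# * x + 1# * y ≈ y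
  lin-0-1 = solve 2 (λ x y → con 0 :* x :+ con 1 :* y := y) refl

  lin-1-0ʳ : ∀ x y → x * 1# + y * 0# ≈ x
  lin-1-0ʳ = solve 2 (λ x y → x :* con 1 :+ y :* con 0 := x) refl

  lin-0-1ʳ : ∀ x y → x * 0# + y * 1# ≈ y
  lin-0-1ʳ = solve 2 (λ x y → x :* con 0 :+ y :* con 1 := y) refl

  lin-lin : ∀ a b p q r s x y →
    (a * p + b * r) * x + (a * q + b * s) * y ≈
    a * (p * x + q * y) + b * (r * x + s * y)
  lin-lin = solve 8 (λ a b p q r s x y →
    (a :* p :+ b :* r) :* x :+ (a :* q :+ b :* s) :* y :=
    a :* (p :* x :+ q :* y) :+ b :* (r :* x :+ s :* y)) refl

  lin-+ : ∀ e a b x y x′ y′ →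
    (e + (a * x + b * y)) + (a * x′ + b * y′) ≈ e + (a * (x + x′) + b * (y + y′))
  lin-+ = solve 7 (λ e a b x y x′ y′ →
    (e :+ (a :* x :+ b :* y)) :+ (a :* x′ :+ b :* y′) :=
    e :+ (a :* (x :+ x′) :+ b :* (y :+ y′))) refl

  lin-neg : ∀ a b x y → a * - x + b * - y ≈ - (a * x + b * y)
  lin-neg a b x y = trans
    (+-cong (sym (-‿distribʳ-* a x)) (sym (-‿distribʳ-* b y)))
    (-‿+-comm (a * x) (b * y))

  +ᵛ-cong : ∀ {u u′ v v′} → u ≈ᵛ u′ → v ≈ᵛ v′ → u +ᵛ v ≈ᵛ u′ +ᵛ v′
  +ᵛ-cong (vec-≈ p q) (vec-≈ p′ q′) = vec-≈ (+-cong p p′) (+-cong q q′)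

  -ᵛ-cong : ∀ {u v} → u ≈ᵛ v → -ᵛ u ≈ᵛ -ᵛ v
  -ᵛ-cong (vec-≈ p q) = vec-≈ (-‿cong p) (-‿cong q)

  ·-cong : ∀ {A A′ B B′} → A ≈ᵐ A′ → B ≈ᵐ B′ → A · B ≈ᵐ A′ · B′
  ·-cong (mat-≈ a b c d) (mat-≈ p q r s) =
    mat-≈ (lin a p b r) (lin a q b s) (lin c p d r) (lin c q d s)

  ·ᵛ-cong : ∀ {A A′ v v′} → A ≈ᵐ A′ → v ≈ᵛ v′ → A ·ᵛ v ≈ᵛ A′ ·ᵛ v′
  ·ᵛ-cong (mat-≈ a b c d) (vec-≈ x y) = vec-≈ (lin a x b y) (lin c x d y)

  ·-assoc : ∀ A B C → (A · B) · C ≈ᵐ A · (B · C)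
  ·-assoc (mat a b c d) (mat p q r s) (mat x y z w) = mat-≈
    (lin-lin a b p q r s x z) (lin-lin a b p q r s y w)
    (lin-lin c d p q r s x z) (lin-lin c d p q r s y w)

  ·ᵛ-assoc : ∀ A B v → (A · B) ·ᵛ v ≈ᵛ A ·ᵛ (B ·ᵛ v)
  ·ᵛ-assoc (mat a b c d) (mat p q r s) (vec x y) =
    vec-≈ (lin-lin a b p q r s x y) (lin-lin c d p q r s x y)

  ·-identityˡ : ∀ A → I₂ · A ≈ᵐ A
  ·-identityˡ (mat a b c d) =
    mat-≈ (lin-1-0 a c) (lin-1-0 b d) (lin-0-1 a c) (lin-0-1 b d)

  ·-identityʳ : ∀ A → A · I₂ ≈ᵐ A
  ·-identityʳ (mat a b c d) =
    mat-≈ (lin-1-0ʳ a b) (lin-0-1ʳ a b) (lin-1-0ʳ c d) (lin-0-1ʳ c d)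

  ·ᵛ-identity : ∀ v → I₂ ·ᵛ v ≈ᵛ v
  ·ᵛ-identity (vec x y) = vec-≈ (lin-1-0 x y) (lin-0-1 x y)

  affine-assoc : ∀ u A v B w →
    (u +ᵛ A ·ᵛ v) +ᵛ (A · B) ·ᵛ w ≈ᵛ u +ᵛ A ·ᵛ (v +ᵛ B ·ᵛ w)
  affine-assoc u A v B w =
    ≈ᵛ-trans (+ᵛ-cong ≈ᵛ-refl (·ᵛ-assoc A B w)) (shuffle u A v (B ·ᵛ w))
    where
    shuffle : ∀ u A v w → (u +ᵛ A ·ᵛ v) +ᵛ A ·ᵛ w ≈ᵛ u +ᵛ A ·ᵛ (v +ᵛ w)
    shuffle (vec e f) (mat a b c d) (vec x y) (vec x′ y′) =
      vec-≈ (lin-+ e a b x y x′ y′) (lin-+ f c d x y x′ y′)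

  ·ᵛ-neg : ∀ A v → A ·ᵛ (-ᵛ v) ≈ᵛ -ᵛ (A ·ᵛ v)
  ·ᵛ-neg (mat a b c d) (vec x y) = vec-≈ (lin-neg a b x y) (lin-neg c d x y)

  ·ᵛ-0 : ∀ A → A ·ᵛ 0ᵛ ≈ᵛ 0ᵛ
  ·ᵛ-0 (mat a b c d) = vec-≈ (zeros a b) (zeros c d)
    where
    zeros : ∀ a b → a * 0# + b * 0# ≈ 0#
    zeros = solve 2 (λ a b → a :* con 0 :+ b :* con 0 := con 0) refl

  open AlgebraDefinitions _≈ᵐ_ using (Invertible)

  record GL₂ : Set (c ⊔ ℓ) where
    constructor gl
    field
      matrix      : Mat₂
      invertible₂ : Invertible I₂ _·_ matrix

    inverseMatrix : Mat₂
    inverseMatrix = proj₁ invertible₂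

  open GL₂ public using (matrix; inverseMatrix)

  I-GL : GL₂
  I-GL = gl I₂ (I₂ , ·-identityˡ I₂ , ·-identityˡ I₂)

  _·ᵍ_ : GL₂ → GL₂ → GL₂
  gl A (A⁻ , A⁻A , AA⁻) ·ᵍ gl B (B⁻ , B⁻B , BB⁻) =
    gl (A · B) (B⁻ · A⁻ , cancel B⁻ A⁻ A B A⁻A B⁻B , cancel A B B⁻ A⁻ BB⁻ AA⁻)
    where
    cancel : ∀ P Q R T → Q · R ≈ᵐ I₂ → P · T ≈ᵐ I₂ → (P · Q) · (R · T) ≈ᵐ I₂
    cancel P Q R T QR PT =
      ≈ᵐ-trans (·-assoc P Q (R · T))
      (≈ᵐ-trans (·-cong (≈ᵐ-refl {P}) (≈ᵐ-sym (·-assoc Q R T)))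
      (≈ᵐ-trans (·-cong (≈ᵐ-refl {P}) (·-cong QR (≈ᵐ-refl {T})))
      (≈ᵐ-trans (·-cong (≈ᵐ-refl {P}) (·-identityˡ T)) PT)))

  inv-GL : GL₂ → GL₂
  inv-GL (gl A (A⁻ , A⁻A , AA⁻)) = gl A⁻ (A , AA⁻ , A⁻A)

  inverse-unique : ∀ A B → matrix A ≈ᵐ matrix B → inverseMatrix A ≈ᵐ inverseMatrix B
  inverse-unique (gl A (A⁻ , A⁻A , AA⁻)) (gl B (B⁻ , B⁻B , BB⁻)) A≈B =
    ≈ᵐ-trans (≈ᵐ-sym (·-identityʳ A⁻))
    (≈ᵐ-trans (·-cong ≈ᵐ-refl (≈ᵐ-sym BB⁻))
    (≈ᵐ-trans (≈ᵐ-sym (·-assoc A⁻ B B⁻))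
    (≈ᵐ-trans (·-cong (·-cong (≈ᵐ-refl {A⁻}) (≈ᵐ-sym A≈B)) ≈ᵐ-refl)
    (≈ᵐ-trans (·-cong A⁻A ≈ᵐ-refl) (·-identityˡ B⁻)))))

  record AffineMap : Set (c ⊔ ℓ) where
    constructor _,,_
    field
      translation : Vec₂
      linear      : GL₂

  -- Invertibility certificates are not compared.
  record _≈ᵃ_ (g h : AffineMap) : Set ℓ where
    constructor aff-≈
    private
      module g = AffineMap g
      module h = AffineMap h
    field
      translation : g.translation ≈ᵛ h.translation
      linear      : matrix g.linear ≈ᵐ matrix h.linear

  AGL₂ : Group (c ⊔ ℓ) ℓ
  AGL₂ = record
    { Carrier = AffineMap
    ; _≈_     = _≈ᵃ_
    ; _∙_     = λ { (a ,, A) (b ,, B) → (a +ᵛ matrix A ·ᵛ b) ,, (A ·ᵍ B) }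
    ; ε       = 0ᵛ ,, I-GL
    ; _⁻¹     = λ { (a ,, A) → (-ᵛ (inverseMatrix A ·ᵛ a)) ,, inv-GL A }
    ; isGroup = record
      { isMonoid = record
        { isSemigroup = record
          { isMagma = record
            { isEquivalence = record
              { refl  = aff-≈ ≈ᵛ-refl ≈ᵐ-refl
              ; sym   = λ { (aff-≈ p q) → aff-≈ (≈ᵛ-sym p) (≈ᵐ-sym q) }
              ; trans = λ { (aff-≈ p q) (aff-≈ p′ q′) →
                            aff-≈ (≈ᵛ-trans p p′) (≈ᵐ-trans q q′) }
              }
            ; ∙-cong = λ { (aff-≈ p q) (aff-≈ p′ q′) →
                           aff-≈ (+ᵛ-cong p (·ᵛ-cong q p′)) (·-cong q q′) }
            }
          ; assoc = λ { (a ,, A) (b ,, B) (d ,, D) → aff-≈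
                        (affine-assoc a (matrix A) b (matrix B) d)
                        (·-assoc (matrix A) (matrix B) (matrix D)) }
          }
        ; identity =
            (λ { (vec x y ,, A) → aff-≈
                 (≈ᵛ-trans (+ᵛ-cong ≈ᵛ-refl (·ᵛ-identity (vec x y)))
                           (vec-≈ (+-identityˡ x) (+-identityˡ y)))
                 (·-identityˡ (matrix A)) })
          , (λ { (vec x y ,, A) → aff-≈
                 (≈ᵛ-trans (+ᵛ-cong ≈ᵛ-refl (·ᵛ-0 (matrix A)))
                           (vec-≈ (+-identityʳ x) (+-identityʳ y)))
                 (·-identityʳ (matrix A)) })
        }
      ; inverse =
          (λ { (a ,, gl A (A⁻ , A⁻A , AA⁻)) →
               aff-≈ (vec-≈ (-‿inverseˡ _) (-‿inverseˡ _)) A⁻A })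
        , (λ { (a ,, gl A (A⁻ , A⁻A , AA⁻)) →
               aff-≈ (inverse-translation a A A⁻ AA⁻) AA⁻ })
      ; ⁻¹-cong = λ { {_ ,, A} {_ ,, B} (aff-≈ p q) →
                      aff-≈ (-ᵛ-cong (·ᵛ-cong (inverse-unique A B q) p))
                            (inverse-unique A B q) }
      }
    }
    where
    inverse-translation : ∀ a A A⁻ → A · A⁻ ≈ᵐ I₂ → a +ᵛ A ·ᵛ (-ᵛ (A⁻ ·ᵛ a)) ≈ᵛ 0ᵛ
    inverse-translation a A A⁻ AA⁻ =
      ≈ᵛ-trans (+ᵛ-cong (≈ᵛ-refl {a}) (≈ᵛ-trans (·ᵛ-neg A (A⁻ ·ᵛ a)) (-ᵛ-cong AA⁻a)))
               (vec-≈ (-‿inverseʳ _) (-‿inverseʳ _))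
      where
      AA⁻a : A ·ᵛ (A⁻ ·ᵛ a) ≈ᵛ a
      AA⁻a = ≈ᵛ-trans (≈ᵛ-sym (·ᵛ-assoc A A⁻ a))
             (≈ᵛ-trans (·ᵛ-cong AA⁻ ≈ᵛ-refl) (·ᵛ-identity a))

  record Translations (K : Pred Carrier k) (g : AffineMap) : Set (ℓ ⊔ k) where
    open AffineMap g
    field
      entry₁   : Vec₂.x₁ translation ∈ K
      entry₂   : Vec₂.x₂ translation ∈ K
      linear-I : matrix linear ≈ᵐ I₂

{-# OPTIONS --safe #-}
module Submission where

-- H is a perfect code as soon as it has an inverse-closed right transversal.
-- The right cosets of H in AGL(2, F) are given by a matrix A and a class in
-- F² / K², so a transversal amounts to a choice of sections T_A of F² → F² / K²,
-- and inversion requires T_{A⁻¹} = A⁻¹ T_A (as −1 = 1). All sections used are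
-- K-linear complements of K² of the form M K², which is a complement as soon as
-- it meets K² in 0, by counting.
--
-- If A² ≠ I, it suffices that M K² is a complement of both K² and A K². Writing
-- F = K ⊕ ω K, ω̄ = ω + s with ω ω̄ ∈ K, and A⁻¹ = P + ω Q over K, the matrix
-- M = ω̄ + B works when det (P + Q B) ≠ 0, and since det A⁻¹ ≠ 0 some diagonal
-- 0-1 matrix B has this property. If A² = I, then A = I + N with N² = 0, and
-- explicit complements of K² stable under N are available.

open import Defs
open import Algebra.Bundles using (CommutativeRing; Group)
open import Algebra.Solver.Ring.AlmostCommutativeRing
  using (_-Raw-AlmostCommutative⟶_; fromCommutativeSemiring)
open import Data.Bool.Base using (Bool; true; false)
import Data.Bool.Properties as Bool
open import Data.Fin.Base using (Fin; punchOut; combine; _≤_)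
open import Data.Fin.Permutation using (permutation)
open import Data.Fin.Properties
  using (any?; ¬∀⟶∃¬; punchOut-injective; injective⇒≤; combine-injective; *↔×)
  renaming (_≟_ to _≟ᶠ_; _≤?_ to _≤ᶠ?_; ≤-total to ≤ᶠ-total; ≤-antisym to ≤ᶠ-antisym)
import Data.Maybe.Base as Maybe
open import Data.Nat.Base using (ℕ; zero; suc; _≥_; _^_)
import Data.Nat.Base as ℕ
import Data.Nat.Properties as ℕ
open import Data.Product using (∃!; ∃-syntax; _×_; _,_; proj₁; proj₂)
import Data.Product.Function.NonDependent.Setoid as ×
open import Data.Product.Relation.Binary.Pointwise.NonDependent using (_×ₛ_; Pointwise-≡↔≡)
open import Data.Sum.Base using (inj₁; inj₂)
open import Function.Base using (_∘_)
open import Function.Bundles using (Bijection; Surjection)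
open import Function.Construct.Composition using () renaming (bijection to _⟨∘⟩_)
open import Function.Construct.Symmetry using (inverse)
open import Function.Definitions using (Congruent; Injective)
open import Function.Properties.Inverse using (Inverse⇒Bijection)
open import Level using (Level; _⊔_)
open import Relation.Binary.Bundles using (Setoid)
open import Relation.Binary.Definitions using (_Respects_; Decidable)
open import Relation.Binary.PropositionalEquality as ≡ using (_≡_)
open import Relation.Nullary.Decidable
  using (Dec; yes; no; map′; _×-dec_; recompute; dec⇒maybe; decidable-stable)
open import Relation.Nullary.Negation using (¬_; contradiction)
open import Relation.Unary using (Pred; _∈_; _∉_; _⊆_)
import Algebra.Properties.CommutativeMonoid.Sum as Sum
import Algebra.Properties.Group as GroupProperties
import Algebra.Properties.Semiring.Mult as Mult
import Algebra.Solver.Ring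
import Relation.Binary.Reasoning.Setoid as SetoidReasoning
import Relation.Unary as Unary

private
  variable
    c ℓ k p c′ ℓ′ : Level

-- Finite setoids and counting.

Fin-injective⇒surjective : ∀ {m} {f : Fin m → Fin m} → Injective _≡_ _≡_ f →
                           ∀ j → ∃[ i ] f i ≡ j
Fin-injective⇒surjective {suc m} {f} inj j with any? (λ i → f i ≟ᶠ j)
... | yes i,fi≡j = i,fi≡j
-- Punching out a missed value `j` would inject `Fin (suc m)` into `Fin m`.
... | no  ∄i     = contradiction (injective⇒≤ {f = avoid} avoid-inj) ℕ.1+n≰n
  where
  j≢f : ∀ i → ¬ j ≡ f i
  j≢f i j≡fi = ∄i (i , ≡.sym j≡fi)

  avoid : Fin (suc m) → Fin m
  avoid i = punchOut (j≢f i)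

  avoid-inj : Injective _≡_ _≡_ avoid
  avoid-inj {x} {y} eq = inj (punchOut-injective (j≢f x) (j≢f y) eq)

module Enumerated (S : Setoid c ℓ) {m : ℕ} (order : HasOrder S m) where
  open Setoid S
  open Bijection order using (to; injective; surjection)

  index : Carrier → Fin m
  index = Surjection.to⁻ surjection

  to-index : ∀ x → to (index x) ≈ x
  to-index = Surjection.to∘to⁻ surjection

  index-to : ∀ i → index (to i) ≡ i
  index-to i = injective (to-index (to i))

  index-cong : Congruent _≈_ _≡_ index
  index-cong {x} {y} x≈y = injective (trans (to-index x) (trans x≈y (sym (to-index y))))

  index-injective : Injective _≈_ _≡_ index
  index-injective {x} {y} eq =
    trans (sym (to-index x)) (trans (reflexive (≡.cong to eq)) (to-index y))

  _≟_ : Decidable _≈_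
  x ≟ y = map′ index-injective index-cong (index x ≟ᶠ index y)

  -- Equivalent elements get identical representatives, so any choice made on representatives
  -- respects `≈`.
  rep : Carrier → Carrier
  rep = to ∘ index

  rep-cong : ∀ {x y} → x ≈ y → rep x ≡ rep y
  rep-cong = ≡.cong to ∘ index-cong

abstract
  injective⇒surjective :
    (S : Setoid c ℓ) (T : Setoid c′ ℓ′) {m : ℕ} → HasOrder S m → HasOrder T m →
    {f : Setoid.Carrier S → Setoid.Carrier T} →
    Injective (Setoid._≈_ S) (Setoid._≈_ T) f → ∀ y → ∃[ x ] Setoid._≈_ T (f x) y
  injective⇒surjective S T S-order T-order {f} inj y =
    let i , eq = Fin-injective⇒surjective {f = T.index ∘ f ∘ S.to}
                   (λ eq → S.injective (inj (T.index-injective eq))) (T.index y)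
    in S.to i , T.index-injective eq
    where
    module S = Bijection S-order
    module T = Enumerated T T-order

HasOrder-× : {S : Setoid c ℓ} {T : Setoid c′ ℓ′} {m n : ℕ} →
             HasOrder S m → HasOrder T n → HasOrder (S ×ₛ T) (m ℕ.* n)
HasOrder-× S-order T-order =
  Inverse⇒Bijection *↔× ⟨∘⟩
  (Inverse⇒Bijection (inverse Pointwise-≡↔≡) ⟨∘⟩
  (S-order ×.×-bijection T-order))

-- Perfect codes from transversals.

-- With the identity removed, an inverse-closed right transversal of H is a
-- connection set whose Cayley graph has H as a perfect code.
inverseClosedTransversal⇒perfectCode :
  (G : Group c ℓ) → let open Group G in (H : Pred Carrier ℓ) (T : Pred Carrier (c ⊔ ℓ)) →
  IsSubgroup G H → T Respects _≈_ → (∀ {x} → x ∈ T → x ⁻¹ ∈ T) →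
  (∀ g → ∃! _≈_ λ h → h ∈ H × h ∙ g ∈ T) →
  IsPerfectCodeOfGroup G H
inverseClosedTransversal⇒perfectCode G H T H≤G T-resp T-inv T-trans =
  (λ g → g ∈ T × g ∉ H) ,
  record
    { resp           = λ { x≈y (x∈T , x∉H) → T-resp x≈y x∈T , x∉H ∘ resp (sym x≈y) }
    ; ε-free         = λ { (_ , ε∉H) → ε∉H ε-closed }
    ; inverse-closed = λ { (x∈T , x∉H) → T-inv x∈T , x∉H ∘ unflip }
    } ,
  record
    { coclique  = λ { u∈H v∈H (_ , vu⁻¹∉H) → vu⁻¹∉H (∙-closed v∈H (⁻¹-closed u∈H)) }
    ; dominates = λ v v∉H →
        -- Adjacency of `v` to `u` concerns `u ∙ v ⁻¹`, so the representative is sought in the coset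
        -- of `v ⁻¹`. It is not in `H`, as otherwise `v` would be.
        let u , (u∈H , uv⁻¹∈T) , unique = T-trans (v ⁻¹)
        in u
         , (u∈H , uv⁻¹∈T , λ uv⁻¹∈H →
              v∉H (unflip (resp (\\-leftDividesʳ u (v ⁻¹)) (∙-closed (⁻¹-closed u∈H) uv⁻¹∈H))))
         , λ { (u′∈H , u′v⁻¹∈T , _) → unique (u′∈H , u′v⁻¹∈T) }
    }
  where
  open Group G
  open GroupProperties G using (⁻¹-involutive; \\-leftDividesʳ)
  open IsSubgroup H≤G

  unflip : ∀ {x} → x ⁻¹ ∈ H → x ∈ H
  unflip {x} x⁻¹∈H = resp (⁻¹-involutive x) (⁻¹-closed x⁻¹∈H)

perfectCode-resp : (G : Group c ℓ) {H : Pred (Group.Carrier G) k} {H′ : Pred (Group.Carrier G) p} →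
                   H ⊆ H′ → H′ ⊆ H → IsPerfectCodeOfGroup G H → IsPerfectCodeOfGroup G H′
perfectCode-resp G H⊆H′ H′⊆H (S , S-conn , code) =
  S , S-conn , record
    { coclique  = λ u∈H′ v∈H′ → coclique (H′⊆H u∈H′) (H′⊆H v∈H′)
    ; dominates = λ v v∉H′ →
        let u , (u∈H , adj) , unique = dominates v (v∉H′ ∘ H⊆H′)
        in u , (H⊆H′ u∈H , adj) , λ { (u′∈H′ , adj′) → unique (H′⊆H u′∈H′ , adj′) }
    }
  where open IsPerfectCode code

-- The characteristic of a field with 2^n elements.

module _ (R : CommutativeRing c ℓ) where
  open CommutativeRing R
  open Mult semiring using () renaming (_×_ to _×′_)

  -- Translation by 1 permutes the ring, so it leaves the sum of all elements
  -- unchanged.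
  order×1≈0 : ∀ {m} → HasOrder setoid m → m ×′ 1# ≈ 0#
  order×1≈0 {m} order = identityʳ-unique (sum to) (m ×′ 1#) (sym (begin
    sum to                          ≈⟨ sum-permute to shift ⟩
    sum (λ i → to (index (to i + 1#))) ≈⟨ sum-cong-≋ {m} (λ i → to-index _) ⟩
    sum (λ i → to i + 1#)           ≈⟨ ∑-distrib-+ to (λ _ → 1#) ⟩
    sum to + sum {m} (λ _ → 1#)     ≈⟨ +-congˡ (sum-replicate m) ⟩
    sum to + m ×′ 1#                 ∎))
    where
    open Sum +-commutativeMonoid
    open GroupProperties +-group using (identityʳ-unique; //-rightDividesˡ; //-rightDividesʳ)
    open Bijection order using (to)
    open Enumerated setoid order using (index; to-index; index-cong; index-to)
    open SetoidReasoning setoid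

    shift = permutation (λ i → index (to i + 1#)) (λ i → index (to i - 1#))
      (λ i → ≡.trans (index-cong (trans (+-congʳ (to-index _)) (//-rightDividesˡ 1# (to i))))
                     (index-to i))
      (λ i → ≡.trans (index-cong (trans (+-congʳ (to-index _)) (//-rightDividesʳ 1# (to i))))
                     (index-to i))

module FieldProperties (F : Field c ℓ) where
  open Field F
  open SetoidReasoning setoid

  module _ (_≟_ : Decidable _≈_) where

    *-cancel-nonzero : ∀ {x y} → ¬ x ≈ 0# → x * y ≈ 0# → y ≈ 0#
    *-cancel-nonzero {x} {y} x≉0 xy≈0 = let x⁻¹ , x⁻¹x≈1 , _ = invertible x≉0 in begin
      y             ≈⟨ *-identityˡ y ⟨
      1# * y        ≈⟨ *-congʳ x⁻¹x≈1 ⟨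
      x⁻¹ * x * y   ≈⟨ *-assoc x⁻¹ x y ⟩
      x⁻¹ * (x * y) ≈⟨ *-congˡ xy≈0 ⟩
      x⁻¹ * 0#      ≈⟨ zeroʳ x⁻¹ ⟩
      0#            ∎

    square≈0 : ∀ {x} → x * x ≈ 0# → x ≈ 0#
    square≈0 {x} x²≈0 = decidable-stable (x ≟ 0#) λ x≉0 → x≉0 (*-cancel-nonzero x≉0 x²≈0)

    open Mult semiring using (×1-homo-*; ×-homo-1) renaming (_×_ to _×′_)

    -- If 2 were nonzero, it could be cancelled from 2^n factor by factor, down to 1 = 0.
    2^n×1≈0⇒1+1≈0 : ∀ n → (2 ^ n) ×′ 1# ≈ 0# → 1# + 1# ≈ 0#
    2^n×1≈0⇒1+1≈0 zero    1≈0    = contradiction (trans (sym 1≈0) (×-homo-1 1#)) 0≉1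
    2^n×1≈0⇒1+1≈0 (suc n) 2q×1≈0 with (1# + 1#) ≟ 0#
    ... | yes 1+1≈0 = 1+1≈0
    ... | no  1+1≉0 = 2^n×1≈0⇒1+1≈0 n (*-cancel-nonzero
      (λ 2×1≈0 → 1+1≉0 (trans (+-congˡ (sym (×-homo-1 1#))) 2×1≈0))
      (trans (sym (×1-homo-* 2 (2 ^ n))) 2q×1≈0))

-- Polynomial identities in characteristic 2.

HasChar2 : CommutativeRing c ℓ → Set ℓ
HasChar2 R = 1# + 1# ≈ 0#
  where open CommutativeRing R

-- The coefficients are 𝔽₂, realised as `Bool` with xor and ∧, so that normal forms cancel repeated
-- terms.
module Char2Solver
  (R : CommutativeRing c ℓ)
  (1+1≈0 : HasChar2 R)
  where

  open CommutativeRing R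

  private
    ⟦_⟧₂ : Bool → Carrier
    ⟦ true  ⟧₂ = 1#
    ⟦ false ⟧₂ = 0#

    ⟦⟧₂-homomorphism : CommutativeRing.rawRing Bool.xor-∧-commutativeRing
                       -Raw-AlmostCommutative⟶ fromCommutativeSemiring commutativeSemiring
    ⟦⟧₂-homomorphism = record
      { ⟦_⟧    = ⟦_⟧₂
      ; +-homo = λ { true true → sym 1+1≈0 ; true false → sym (+-identityʳ 1#)
                   ; false y → sym (+-identityˡ ⟦ y ⟧₂) }
      ; *-homo = λ { true y → sym (*-identityˡ ⟦ y ⟧₂) ; false y → sym (zeroˡ ⟦ y ⟧₂) }
      ; -‿homo = λ _ → refl
      ; 0-homo = refl
      ; 1-homo = refl
      }

  open Algebra.Solver.Ring
    (CommutativeRing.rawRing Bool.xor-∧-commutativeRing)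
    (fromCommutativeSemiring commutativeSemiring)
    ⟦⟧₂-homomorphism
    (λ x y → Maybe.map (reflexive ∘ ≡.cong ⟦_⟧₂) (dec⇒maybe (x Bool.≟ y)))
    public using (Polynomial; solve; _:=_; _:+_; _:*_; con)

  :0 :1 : ∀ {n} → Polynomial n
  :0 = con false
  :1 = con true

-- The translation subgroup: closure, non-normality, failure of `Φ`.

module _ (F : Field c ℓ) {K : Pred (Field.Carrier F) k} (K≤F : IsSubfield F K) where
  open Field F
  open Affine F
  open IsSubfield K≤F
  open SetoidReasoning setoid

  translations-subgroup : IsSubgroup (Affine.AGL₂ F) (Affine.Translations F K)
  translations-subgroup = record
    { resp      = λ { (aff-≈ (vec-≈ p q) r) h∈H → record
        { entry₁ = resp p (entry₁ h∈H) ; entry₂ = resp q (entry₂ h∈H)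
        ; linear-I = ≈ᵐ-trans (≈ᵐ-sym r) (linear-I h∈H) } }
    ; ε-closed  = record { entry₁ = 0-closed ; entry₂ = 0-closed ; linear-I = ≈ᵐ-refl }
    ; ∙-closed  = λ { {_ ,, A} {vec x y ,, B} g∈H h∈H →
        let vec-≈ p q = ≈ᵛ-trans (·ᵛ-cong (linear-I g∈H) ≈ᵛ-refl) (·ᵛ-identity (vec x y))
        in record
        { entry₁ = +-closed (entry₁ g∈H) (resp (sym p) (entry₁ h∈H))
        ; entry₂ = +-closed (entry₂ g∈H) (resp (sym q) (entry₂ h∈H))
        ; linear-I = ≈ᵐ-trans (·-cong (linear-I g∈H) (linear-I h∈H)) (·-identityˡ I₂) } }
    ; ⁻¹-closed = λ { {vec x y ,, A} g∈H →
        let A⁻≈I = inverse-unique A I-GL (linear-I g∈H)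
            vec-≈ p q = ≈ᵛ-trans (·ᵛ-cong A⁻≈I ≈ᵛ-refl) (·ᵛ-identity (vec x y))
        in record
        { entry₁ = neg-closed (resp (sym p) (entry₁ g∈H))
        ; entry₂ = neg-closed (resp (sym q) (entry₂ g∈H))
        ; linear-I = A⁻≈I } }
    }
    where open Affine.Translations

  module _ {ω : Carrier} (ω∉K : ω ∉ K) where

    ω≉0 : ¬ ω ≈ 0#
    ω≉0 ω≈0 = ω∉K (resp (sym ω≈0) 0-closed)

    ω⁻¹ : Carrier
    ω⁻¹ = proj₁ (invertible ω≉0)

    ω⁻¹ω≈1 : ω⁻¹ * ω ≈ 1#
    ω⁻¹ω≈1 = proj₁ (proj₂ (invertible ω≉0))

    ωω⁻¹≈1 : ω * ω⁻¹ ≈ 1#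
    ωω⁻¹≈1 = proj₂ (proj₂ (invertible ω≉0))

    -- Conjugation by diag(ω, 1) turns the translation by (1, 0) into the translation by (ω, 0).
    translations-not-normal : ¬ IsNormal (Affine.AGL₂ F) (Affine.Translations F K)
    translations-not-normal normal = ω∉K (resp conjugate≈ω (entry₁ (normal g {h} h∈H)))
      where
      open Affine.Translations

      scale : GL₂
      scale = gl (mat ω 0# 0# 1#) (mat ω⁻¹ 0# 0# 1#
        , mat-≈ (inv ω⁻¹ω≈1) (lin-0-1ʳ _ _) (lin-0-1 _ _) (lin-0-1 _ _)
        , mat-≈ (inv ωω⁻¹≈1) (lin-0-1ʳ _ _) (lin-0-1 _ _) (lin-0-1 _ _))
        where
        inv : ∀ {x y} → x * y ≈ 1# → x * y + 0# * 0# ≈ 1#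
        inv xy≈1 = trans (+-cong xy≈1 (zeroˡ 0#)) (+-identityʳ 1#)

      g h : AffineMap
      g = 0ᵛ ,, scale
      h = vec 1# 0# ,, I-GL

      h∈H : h ∈ Affine.Translations F K
      h∈H = record { entry₁ = 1-closed ; entry₂ = 0-closed ; linear-I = ≈ᵐ-refl }

      open Group (Affine.AGL₂ F) using (_∙_; _⁻¹)

      conjugate≈ω : Vec₂.x₁ (AffineMap.translation
        ((g ∙ h) ∙ g ⁻¹)) ≈ ω
      conjugate≈ω = trans
        (+-congˡ {0# + (ω * 1# + 0# * 0#)} (Vec₂≈.x₁ (≈ᵛ-trans
          (·ᵛ-cong (≈ᵐ-refl {matrix scale · I₂})
            (≈ᵛ-trans (-ᵛ-cong (·ᵛ-0 _)) (vec-≈ -0#≈0# -0#≈0#)))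
          (·ᵛ-0 _))))
        (trans (+-identityʳ _) (trans (+-identityˡ _) (lin-1-0ʳ ω 0#)))
        where
        open import Algebra.Properties.Ring ring using (-0#≈0#)
        module Vec₂≈ = _≈ᵛ_

    -- Take g = ((0, ω⁻¹), A) with A the transvection by ω. Then g² is
    -- translation by (1, 0), while changing g by b ∈ K² changes the square by
    -- (ω b₂, 0), which is (1, 0) only for b₂ = ω⁻¹ ∉ K.
    ¬Φ-translations : 1# + 1# ≈ 0# → ¬ Φ (Affine.AGL₂ F) (Affine.Translations F K)
    ¬Φ-translations 1+1≈0 Φ =
      let h , h∈H , aff-≈ (vec-≈ eq _) _ = Φ g g²∈H
          mat-≈ m₁₁≈1 m₁₂≈ω _ _ =
            ≈ᵐ-trans (·-cong (≈ᵐ-refl {A}) (linear-I h∈H)) (·-identityʳ A)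
      in ω∉K (inv-closed (entry₂ h∈H) (cofactor _ _ m₁₁≈1 m₁₂≈ω eq))
      where
      open Affine.Translations
      open Char2Solver commutativeRing 1+1≈0
      open Group (Affine.AGL₂ F) using (_∙_; ε)

      A : Mat₂
      A = mat 1# ω 0# 1#

      A²≈I : A · A ≈ᵐ I₂
      A²≈I = mat-≈
        (solve 1 (λ w → :1 :* :1 :+ w :* :0 := :1) refl ω)
        (solve 1 (λ w → :1 :* w :+ w :* :1 := :0) refl ω)
        (lin-1-0ʳ 0# 1#) (lin-0-1 ω 1#)

      g : AffineMap
      g = vec 0# ω⁻¹ ,, gl A (A , A²≈I , A²≈I)

      g²∈H : g ∙ g ∈ Affine.Translations F K
      g²∈H = record
        { entry₁ = resp
            (sym (trans (solve 2 (λ w v → :0 :+ (:1 :* :0 :+ w :* v) := w :* v) refl ω ω⁻¹) ωω⁻¹≈1))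
            1-closed
        ; entry₂ = resp (solve 1 (λ v → :0 := v :+ (:0 :* :0 :+ :1 :* v)) refl ω⁻¹) 0-closed
        ; linear-I = A²≈I
        }

      -- Here `t₁`, `t₂` are the translation coordinates of `g ∙ h`, and `m₁₁`, `m₁₂` the first row
      -- of its linear part. The first coordinate of the square is t₁ + t₁ + ω t₂ = ω (ω⁻¹ + b₂).
      cofactor : ∀ b₁ b₂ {m₁₁ m₁₂} → m₁₁ ≈ 1# → m₁₂ ≈ ω →
                 let t₁ = 0# + (1# * b₁ + ω * b₂)
                     t₂ = ω⁻¹ + (0# * b₁ + 1# * b₂)
                 in t₁ + (m₁₁ * t₁ + m₁₂ * t₂) ≈ 0# → b₂ * ω ≈ 1#
      cofactor b₁ b₂ {m₁₁} {m₁₂} m₁₁≈1 m₁₂≈ω eq = begin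
        b₂ * ω                                       ≈⟨ +-identityʳ _ ⟨
        b₂ * ω + 0#                                  ≈⟨ +-congˡ eq ⟨
        b₂ * ω + (t₁ + (m₁₁ * t₁ + m₁₂ * t₂))
          ≈⟨ +-congˡ (+-congˡ (lin m₁₁≈1 refl m₁₂≈ω refl)) ⟩
        b₂ * ω + (t₁ + (1# * t₁ + ω * t₂))
          ≈⟨ solve 4 (λ w v x y → let t = :0 :+ (:1 :* x :+ w :* y) in
               y :* w :+ (t :+ (:1 :* t :+ w :* (v :+ (:0 :* x :+ :1 :* y)))) := w :* v)
               refl ω ω⁻¹ b₁ b₂ ⟩
        ω * ω⁻¹                                      ≈⟨ ωω⁻¹≈1 ⟩
        1#                                           ∎
        where
        t₁ = 0# + (1# * b₁ + ω * b₂)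
        t₂ = ω⁻¹ + (0# * b₁ + 1# * b₂)

-- Complements of K² in F².

module Complements
  (F : Field c ℓ) {K : Pred (Field.Carrier F) ℓ} (K≤F : IsSubfield F K)
  (K? : Unary.Decidable K) {q : ℕ}
  (F-order : HasOrder (Field.setoid F) (q ℕ.* q))
  (K-order : HasOrder (subsetoid (Field.setoid F) K) q)
  (1+1≈0 : HasChar2 (Field.commutativeRing F)) {ω : Field.Carrier F} (ω∉K : ω ∉ K)
  where

  open Field F
  open Affine F
  open IsSubfield K≤F
  open Char2Solver commutativeRing 1+1≈0
  open Enumerated setoid F-order
    using (_≟_; index; index-cong; index-injective; rep; rep-cong; to-index)
  open FieldProperties F using (*-cancel-nonzero; square≈0)
  open SetoidReasoning setoid

  x+x≈0 : ∀ x → x + x ≈ 0#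
  x+x≈0 = solve 1 (λ x → x :+ x := :0) refl

  +-move : ∀ {x y z} → x + y ≈ z → x ≈ z + y
  +-move {x} {y} x+y≈z = trans (solve 2 (λ x y → x := x :+ y :+ y) refl x y) (+-congʳ x+y≈z)

  x+y≈0⇒x≈y : ∀ {x y} → x + y ≈ 0# → x ≈ y
  x+y≈0⇒x≈y x+y≈0 = trans (+-move x+y≈0) (+-identityˡ _)

  x≈y⇒x+y≈0 : ∀ {x y} → x ≈ y → x + y ≈ 0#
  x≈y⇒x+y≈0 {y = y} x≈y = trans (+-congʳ x≈y) (x+x≈0 y)

  -- Brings a hypothesis `z ≈ 0#` into a solver proof: the solver checks an identity with the
  -- explicit multiple `z * w`, which is then discarded.
  modulo : ∀ {x y z w} → x ≈ y + z * w → z ≈ 0# → x ≈ y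
  modulo {y = y} {z} {w} x≈y+zw z≈0 = begin
    _          ≈⟨ x≈y+zw ⟩
    y + z * w  ≈⟨ +-congˡ (*-congʳ z≈0) ⟩
    y + 0# * w ≈⟨ +-congˡ (zeroˡ w) ⟩
    y + 0#     ≈⟨ +-identityʳ y ⟩
    y          ∎

  dropʳ : ∀ a x y → a * x + 0# * y ≈ a * x
  dropʳ = solve 3 (λ a x y → a :* x :+ :0 :* y := a :* x) refl

  dropˡ : ∀ a x y → 0# * x + a * y ≈ a * y
  dropˡ = solve 3 (λ a x y → :0 :* x :+ a :* y := a :* y) refl

  -- A nonzero `x` could be divided out inside `K`, giving `α ∈ K`.
  *-cancel-∉ : ∀ {α x} → α ∉ K → x ∈ K → α * x ∈ K → x ≈ 0#
  *-cancel-∉ {α} {x} α∉K x∈K αx∈K = decidable-stable (x ≟ 0#) λ x≉0 →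
    let x⁻¹ , _ , xx⁻¹≈1 = invertible x≉0 in
    α∉K (resp (trans (*-assoc α x x⁻¹) (trans (*-congˡ xx⁻¹≈1) (*-identityʳ α)))
              (*-closed αx∈K (inv-closed x∈K xx⁻¹≈1)))

  +-cancel-∈ : ∀ {x y} → x ∈ K → x + y ∈ K → y ∈ K
  +-cancel-∈ {x} {y} x∈K x+y∈K =
    resp (solve 2 (λ x y → x :+ (x :+ y) := y) refl x y) (+-closed x∈K x+y∈K)

  private
    KS = subsetoid setoid K

  -- The map (x, y) ↦ x + ω y from K × K is injective because `ω ∉ K`, and both sides have q²
  -- elements.
  F≈K+ωK : ∀ z → ∃[ x ] ∃[ y ] (x ∈ K × y ∈ K × z ≈ x + ω * y)
  F≈K+ωK z =
    let ((x , x∈K) , (y , y∈K)) , eq =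
          injective⇒surjective (KS ×ₛ KS) setoid (HasOrder-× K-order K-order) F-order
            (λ {u} {v} → f-inj {u} {v}) z
    in x , y , x∈K , y∈K , sym eq
    where
    f : Setoid.Carrier (KS ×ₛ KS) → Carrier
    f ((x , _) , (y , _)) = x + ω * y

    f-inj : Injective (Setoid._≈_ (KS ×ₛ KS)) _≈_ f
    f-inj {(x , x∈K) , (y , y∈K)} {(x′ , x′∈K) , (y′ , y′∈K)} eq = x+y≈0⇒x≈y x+x′≈0 , y≈y′
      where
      ω[y+y′]≈x+x′ : ω * (y + y′) ≈ x + x′
      ω[y+y′]≈x+x′ = x+y≈0⇒x≈y (trans
        (solve 5 (λ w x y x′ y′ → w :* (y :+ y′) :+ (x :+ x′)
           := (x :+ w :* y) :+ (x′ :+ w :* y′)) refl ω x y x′ y′)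
        (x≈y⇒x+y≈0 eq))

      y≈y′ : y ≈ y′
      y≈y′ = x+y≈0⇒x≈y (*-cancel-∉ ω∉K (+-closed y∈K y′∈K)
        (resp (sym ω[y+y′]≈x+x′) (+-closed x∈K x′∈K)))

      x+x′≈0 : x + x′ ≈ 0#
      x+x′≈0 = trans (sym ω[y+y′]≈x+x′) (trans (*-congˡ (x≈y⇒x+y≈0 y≈y′)) (zeroʳ ω))

  K² : Pred Vec₂ ℓ
  K² v = Vec₂.x₁ v ∈ K × Vec₂.x₂ v ∈ K

  K²-resp : K² Respects _≈ᵛ_
  K²-resp (vec-≈ p q) (v₁∈K , v₂∈K) = resp p v₁∈K , resp q v₂∈K

  K²-+ᵛ-closed : ∀ {u v} → u ∈ K² → v ∈ K² → u +ᵛ v ∈ K²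
  K²-+ᵛ-closed (u₁∈K , u₂∈K) (v₁∈K , v₂∈K) = +-closed u₁∈K v₁∈K , +-closed u₂∈K v₂∈K

  Image : Mat₂ → Pred Vec₂ (c ⊔ ℓ)
  Image M v = ∃[ u ] (u ∈ K² × M ·ᵛ u ≈ᵛ v)

  -- Since 0 ∈ K², this also contains the injectivity of `M` on `K²`, so that `M K²` is as large as
  -- `K²`.
  Disjoint : Mat₂ → Set (c ⊔ ℓ)
  Disjoint M = ∀ {v} → v ∈ K² → M ·ᵛ v ∈ K² → v ≈ᵛ 0ᵛ

  Disjoint-resp : Disjoint Respects _≈ᵐ_
  Disjoint-resp M≈N disjoint v∈K² Nv∈K² =
    disjoint v∈K² (K²-resp (·ᵛ-cong (≈ᵐ-sym M≈N) ≈ᵛ-refl) Nv∈K²)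

  -- The equation rearranges to M (u + u′) = b + b′ ∈ K², which forces u + u′ = 0.
  disjoint⇒injective : ∀ {M} → Disjoint M → ∀ {b u b′ u′} →
    b ∈ K² → u ∈ K² → b′ ∈ K² → u′ ∈ K² →
    b +ᵛ M ·ᵛ u ≈ᵛ b′ +ᵛ M ·ᵛ u′ → b ≈ᵛ b′ × u ≈ᵛ u′
  disjoint⇒injective {M@(mat m₁₁ m₁₂ m₂₁ m₂₂)} disjoint
    {vec b₁ b₂} {vec u₁ u₂} {vec b₁′ b₂′} {vec u₁′ u₂′} b∈K² u∈K² b′∈K² u′∈K² (vec-≈ p q) =
      vec-≈ (x+y≈0⇒x≈y (trans (sym M[u+u′]≈b+b′.x₁) M[u+u′]≈0.x₁))
            (x+y≈0⇒x≈y (trans (sym M[u+u′]≈b+b′.x₂) M[u+u′]≈0.x₂))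
    , vec-≈ (x+y≈0⇒x≈y u+u′≈0.x₁) (x+y≈0⇒x≈y u+u′≈0.x₂)
    where
    move : ∀ m n b x y b′ x′ y′ → b + (m * x + n * y) ≈ b′ + (m * x′ + n * y′) →
           m * (x + x′) + n * (y + y′) ≈ b + b′
    move m n b x y b′ x′ y′ eq = x+y≈0⇒x≈y (trans
      (solve 8 (λ m n b x y b′ x′ y′ →
         (m :* (x :+ x′) :+ n :* (y :+ y′)) :+ (b :+ b′) :=
         (b :+ (m :* x :+ n :* y)) :+ (b′ :+ (m :* x′ :+ n :* y′))) refl m n b x y b′ x′ y′)
      (x≈y⇒x+y≈0 eq))

    u+u′ = vec u₁ u₂ +ᵛ vec u₁′ u₂′

    M[u+u′]≈b+b′ : M ·ᵛ u+u′ ≈ᵛ vec b₁ b₂ +ᵛ vec b₁′ b₂′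
    M[u+u′]≈b+b′ = vec-≈ (move m₁₁ m₁₂ b₁ u₁ u₂ b₁′ u₁′ u₂′ p) (move m₂₁ m₂₂ b₂ u₁ u₂ b₂′ u₁′ u₂′ q)

    u+u′≈0 : u+u′ ≈ᵛ 0ᵛ
    u+u′≈0 = disjoint (K²-+ᵛ-closed u∈K² u′∈K²)
      (K²-resp (≈ᵛ-sym M[u+u′]≈b+b′) (K²-+ᵛ-closed b∈K² b′∈K²))

    module M[u+u′]≈b+b′ = _≈ᵛ_ M[u+u′]≈b+b′
    module u+u′≈0 = _≈ᵛ_ u+u′≈0
    module M[u+u′]≈0 = _≈ᵛ_ (≈ᵛ-trans (·ᵛ-cong (≈ᵐ-refl {M}) u+u′≈0) (·ᵛ-0 M))

  private
    K²S = KS ×ₛ KS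
    F²S = setoid ×ₛ setoid

  -- The injection (b, u) ↦ b + M u goes from K² × K² to F², both of order q⁴.
  disjoint⇒spanning : ∀ {M} → Disjoint M →
    ∀ a → ∃[ b ] ∃[ u ] (b ∈ K² × u ∈ K² × b +ᵛ M ·ᵛ u ≈ᵛ a)
  disjoint⇒spanning {M} disjoint (vec a₁ a₂) =
    let (((b₁ , b₁∈K) , (b₂ , b₂∈K)) , ((u₁ , u₁∈K) , (u₂ , u₂∈K))) , (p , q) =
          injective⇒surjective (K²S ×ₛ K²S) F²S
            (HasOrder-× (HasOrder-× K-order K-order) (HasOrder-× K-order K-order))
            (HasOrder-× F-order F-order) (λ {u} {v} → f-inj {u} {v}) (a₁ , a₂)
    in vec b₁ b₂ , vec u₁ u₂ , (b₁∈K , b₂∈K) , (u₁∈K , u₂∈K) , vec-≈ p q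
    where
    f : Setoid.Carrier (K²S ×ₛ K²S) → Setoid.Carrier F²S
    f (((b₁ , _) , (b₂ , _)) , ((u₁ , _) , (u₂ , _))) =
      let vec x y = vec b₁ b₂ +ᵛ M ·ᵛ vec u₁ u₂ in x , y

    f-inj : Injective (Setoid._≈_ (K²S ×ₛ K²S)) (Setoid._≈_ F²S) f
    f-inj {((_ , b₁∈K) , (_ , b₂∈K)) , ((_ , u₁∈K) , (_ , u₂∈K))}
          {((_ , b₁′∈K) , (_ , b₂′∈K)) , ((_ , u₁′∈K) , (_ , u₂′∈K))} (p , q) =
      let vec-≈ p₁ p₂ , vec-≈ q₁ q₂ = disjoint⇒injective {M} disjoint
            (b₁∈K , b₂∈K) (u₁∈K , u₂∈K) (b₁′∈K , b₂′∈K) (u₁′∈K , u₂′∈K) (vec-≈ p q)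
      in (p₁ , p₂) , (q₁ , q₂)

  -- In characteristic 2, b + M u = a means M u = b + a, so `b` is the `K²`-component of `a`.
  disjoint⇒transversal : ∀ {M} → Disjoint M → ∀ a → ∃! _≈ᵛ_ λ b → b ∈ K² × b +ᵛ a ∈ Image M
  disjoint⇒transversal {M} disjoint a with disjoint⇒spanning {M} disjoint a
  ... | b , u , b∈K² , u∈K² , b+Mu≈a =
    b , (b∈K² , u , u∈K² , flip b (M ·ᵛ u) a b+Mu≈a)
      , λ { {b′} (b′∈K² , u′ , u′∈K² , Mu′≈b′+a) →
           proj₁ (disjoint⇒injective {M} disjoint b∈K² u∈K² b′∈K² u′∈K²
             (≈ᵛ-trans b+Mu≈a (flip b′ a (M ·ᵛ u′) (≈ᵛ-sym Mu′≈b′+a)))) }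
    where
    flip : ∀ u v w → u +ᵛ v ≈ᵛ w → v ≈ᵛ u +ᵛ w
    flip _ _ _ (vec-≈ p q) = vec-≈ (flip₁ p) (flip₁ q)
      where
      flip₁ : ∀ {x y z} → x + y ≈ z → y ≈ x + z
      flip₁ {x} {y} p = trans (+-move (trans (+-comm y x) p)) (+-comm _ x)

  -- With `M K²` as the section at `A`, inversion forces `A⁻ M K²` at `A⁻`, so both must be
  -- complements of `K²`. If `A` is its own inverse, the two sections must agree, hence `stable`.
  record Complement (A A⁻ : Mat₂) : Set (c ⊔ ℓ) where
    field
      M         : Mat₂
      disjoint  : Disjoint M
      disjoint⁻ : Disjoint (A⁻ · M)
      stable    : A ≈ᵐ A⁻ → ∀ {v} → v ∈ K² → A ·ᵛ (M ·ᵛ v) ∈ Image M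

  -- Complements for matrices with A² ≠ I.

  det : Mat₂ → Carrier
  det (mat a b c d) = a * d + b * c

  det≉0 : ∀ {A A⁻} → A · A⁻ ≈ᵐ I₂ → ¬ det A⁻ ≈ 0#
  det≉0 {A} {A⁻} AA⁻≈I detA⁻≈0 = 0≉1 (sym (begin
    1#            ≈⟨ solve 0 (:1 := :1 :* :1 :+ :0 :* :0) refl ⟩
    det I₂        ≈⟨ det-cong (≈ᵐ-sym AA⁻≈I) ⟩
    det (A · A⁻)  ≈⟨ det-· A A⁻ ⟩
    det A * det A⁻ ≈⟨ *-congˡ detA⁻≈0 ⟩
    det A * 0#    ≈⟨ zeroʳ (det A) ⟩
    0#            ∎))
    where
    det-cong : ∀ {A B} → A ≈ᵐ B → det A ≈ det B
    det-cong (mat-≈ p q r s) = lin p s q r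

    det-· : ∀ A B → det (A · B) ≈ det A * det B
    det-· (mat a b c d) (mat a′ b′ c′ d′) =
      solve 8 (λ a b c d a′ b′ c′ d′ →
        (a :* a′ :+ b :* c′) :* (c :* b′ :+ d :* d′) :+
        (a :* b′ :+ b :* d′) :* (c :* a′ :+ d :* c′) :=
        (a :* d :+ b :* c) :* (a′ :* d′ :+ b′ :* c′)) refl a b c d a′ b′ c′ d′

  -- ω + s is the conjugate of ω: since ω (ω + s) = t ∈ K, the product
  -- (P + ω Q) M has no ω² term.
  conjugate-diagonal : (s β₁ β₂ : Carrier) → Mat₂
  conjugate-diagonal s β₁ β₂ = mat (ω + s + β₁) 0# 0# (ω + s + β₂)

  -- Both diagonal entries differ from `ω` by an element of `K`, so they lie outside `K`.
  diagonal-disjoint : ∀ {s β₁ β₂} → s ∈ K → β₁ ∈ K → β₂ ∈ K → Disjoint (conjugate-diagonal s β₁ β₂)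
  diagonal-disjoint {s} s∈K β₁∈K β₂∈K {vec x y} (x∈K , y∈K) (p , q) =
    vec-≈ (*-cancel-∉ (ω+s+β∉K β₁∈K) x∈K (resp (dropʳ _ _ _) p))
          (*-cancel-∉ (ω+s+β∉K β₂∈K) y∈K (resp (dropˡ _ _ _) q))
    where
    ω+s+β∉K : ∀ {β} → β ∈ K → ω + s + β ∉ K
    ω+s+β∉K {β} β∈K ω+s+β∈K =
      ω∉K (+-cancel-∈ (+-closed s∈K β∈K)
        (resp (solve 3 (λ w s b → w :+ s :+ b := s :+ b :+ w) refl ω s β) ω+s+β∈K))

  private
    module _ {y₁₁ y₁₂ y₂₁ y₂₂ p₁₁ q₁₁ p₁₂ q₁₂ p₂₁ q₂₁ p₂₂ q₂₂ : Carrier}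
      (y₁₁≈ : y₁₁ ≈ p₁₁ + ω * q₁₁) (y₁₂≈ : y₁₂ ≈ p₁₂ + ω * q₁₂)
      (y₂₁≈ : y₂₁ ≈ p₂₁ + ω * q₂₁) (y₂₂≈ : y₂₂ ≈ p₂₂ + ω * q₂₂)
      where

      -- det (P + Q · diag(β₁, β₂))
      shiftedDet : Carrier → Carrier → Carrier
      shiftedDet β₁ β₂ =
        (p₁₁ + q₁₁ * β₁) * (p₂₂ + q₂₂ * β₂) + (p₁₂ + q₁₂ * β₂) * (p₂₁ + q₂₁ * β₁)

      -- Over 𝔽₂ the coefficients of the polynomial det (P + X Q) are
      -- combinations of the four shifted determinants below.
      det≈shiftedDets : let D = shiftedDet in
        det (mat y₁₁ y₁₂ y₂₁ y₂₂) ≈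
        D 0# 0# + ω * (D 1# 0# + D 0# 1#) +
        ω * ω * (D 0# 0# + D 1# 0# + D 0# 1# + D 1# 1#)
      det≈shiftedDets = trans (lin y₁₁≈ y₂₂≈ y₁₂≈ y₂₁≈)
        (solve 9 (λ w p₁₁ q₁₁ p₁₂ q₁₂ p₂₁ q₂₁ p₂₂ q₂₂ →
          let D = λ β₁ β₂ → (p₁₁ :+ q₁₁ :* β₁) :* (p₂₂ :+ q₂₂ :* β₂) :+
                            (p₁₂ :+ q₁₂ :* β₂) :* (p₂₁ :+ q₂₁ :* β₁)
          in (p₁₁ :+ w :* q₁₁) :* (p₂₂ :+ w :* q₂₂) :+ (p₁₂ :+ w :* q₁₂) :* (p₂₁ :+ w :* q₂₁) :=
             D :0 :0 :+ w :* (D :1 :0 :+ D :0 :1) :+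
             w :* w :* (D :0 :0 :+ D :1 :0 :+ D :0 :1 :+ D :1 :1))
          refl ω p₁₁ q₁₁ p₁₂ q₁₂ p₂₁ q₂₁ p₂₂ q₂₂)

      shiftedDet≉0 : ¬ det (mat y₁₁ y₁₂ y₂₁ y₂₂) ≈ 0# →
        ∃[ β₁ ] ∃[ β₂ ] (β₁ ∈ K × β₂ ∈ K × ¬ shiftedDet β₁ β₂ ≈ 0#)
      shiftedDet≉0 det≉0 with shiftedDet 0# 0# ≟ 0# | shiftedDet 1# 0# ≟ 0#
                            | shiftedDet 0# 1# ≟ 0# | shiftedDet 1# 1# ≟ 0#
      ... | no D≉0 | _ | _ | _ = 0# , 0# , 0-closed , 0-closed , D≉0
      ... | _ | no D≉0 | _ | _ = 1# , 0# , 1-closed , 0-closed , D≉0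
      ... | _ | _ | no D≉0 | _ = 0# , 1# , 0-closed , 1-closed , D≉0
      ... | _ | _ | _ | no D≉0 = 1# , 1# , 1-closed , 1-closed , D≉0
      ... | yes D₀₀≈0 | yes D₁₀≈0 | yes D₀₁≈0 | yes D₁₁≈0 =
        contradiction (trans det≈shiftedDets (trans
          (+-cong (+-cong D₀₀≈0 (*-congˡ (+-cong D₁₀≈0 D₀₁≈0)))
                  (*-congˡ (+-cong (+-cong (+-cong D₀₀≈0 D₁₀≈0) D₀₁≈0) D₁₁≈0)))
          (solve 1 (λ w → :0 :+ w :* (:0 :+ :0) :+ w :* w :* (:0 :+ :0 :+ :0 :+ :0) := :0) refl ω)))
        det≉0

      -- With B = diag(β₁, β₂), the product (P + ω Q)(ω + s + B) is P (s + B) + t Q + ω (P + Q B).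
      -- If it maps v ∈ K² into K², then (P + Q B) v = 0, and the nonzero determinant gives v = 0.
      product-disjoint : ∀ {s t β₁ β₂} → s ∈ K → t ∈ K → ω * ω ≈ t + ω * s →
        (p₁₁ ∈ K × p₁₂ ∈ K) × (p₂₁ ∈ K × p₂₂ ∈ K) →
        (q₁₁ ∈ K × q₁₂ ∈ K) × (q₂₁ ∈ K × q₂₂ ∈ K) →
        β₁ ∈ K → β₂ ∈ K → ¬ shiftedDet β₁ β₂ ≈ 0# →
        Disjoint (mat y₁₁ y₁₂ y₂₁ y₂₂ · conjugate-diagonal s β₁ β₂)
      product-disjoint {s} {t} {β₁} {β₂} s∈K t∈K ω²≈t+ωs P∈K Q∈K β₁∈K β₂∈K D≉0
        {vec x y} (x∈K , y∈K) (e₁∈K , e₂∈K) = vec-≈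
        -- Cramer's rule: the adjugate turns the two vanishing rows into det · x = 0, and below into
        -- det · y = 0.
        (*-cancel-nonzero _≟_ D≉0 (trans
          (solve 6 (λ a b c d x y → (a :* d :+ b :* c) :* x :=
            d :* (a :* x :+ b :* y) :+ b :* (c :* x :+ d :* y)) refl d₁₁ d₁₂ d₂₁ d₂₂ x y)
          (trans (lin refl row₁≈0 refl row₂≈0) (lin-0 d₂₂ d₁₂))))
        (*-cancel-nonzero _≟_ D≉0 (trans
          (solve 6 (λ a b c d x y → (a :* d :+ b :* c) :* y :=
            c :* (a :* x :+ b :* y) :+ a :* (c :* x :+ d :* y)) refl d₁₁ d₁₂ d₂₁ d₂₂ x y)
          (trans (lin refl row₁≈0 refl row₂≈0) (lin-0 d₂₁ d₁₁))))
        where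
        d₁₁ = p₁₁ + q₁₁ * β₁
        d₁₂ = p₁₂ + q₁₂ * β₂
        d₂₁ = p₂₁ + q₂₁ * β₁
        d₂₂ = p₂₂ + q₂₂ * β₂

        lin-0 : ∀ m n → m * 0# + n * 0# ≈ 0#
        lin-0 = solve 2 (λ m n → m :* :0 :+ n :* :0 := :0) refl

        row≈0 : ∀ {m n p₁ q₁ p₂ q₂} → m ≈ p₁ + ω * q₁ → n ≈ p₂ + ω * q₂ →
                p₁ ∈ K × p₂ ∈ K → q₁ ∈ K × q₂ ∈ K →
                (m * (ω + s + β₁) + n * 0#) * x + (m * 0# + n * (ω + s + β₂)) * y ∈ K →
                (p₁ + q₁ * β₁) * x + (p₂ + q₂ * β₂) * y ≈ 0#
        row≈0 {m} {n} {p₁} {q₁} {p₂} {q₂} m≈ n≈ (p₁∈K , p₂∈K) (q₁∈K , q₂∈K) e∈K =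
          *-cancel-∉ ω∉K imaginary∈K (+-cancel-∈ real∈K (resp e≈real+ω·imaginary e∈K))
          where
          imaginary = (p₁ + q₁ * β₁) * x + (p₂ + q₂ * β₂) * y
          real = (p₁ * (s + β₁) + t * q₁) * x + (p₂ * (s + β₂) + t * q₂) * y

          imaginary∈K : imaginary ∈ K
          imaginary∈K = +-closed (*-closed (+-closed p₁∈K (*-closed q₁∈K β₁∈K)) x∈K)
                                 (*-closed (+-closed p₂∈K (*-closed q₂∈K β₂∈K)) y∈K)

          real∈K : real ∈ K
          real∈K = +-closed
            (*-closed (+-closed (*-closed p₁∈K (+-closed s∈K β₁∈K)) (*-closed t∈K q₁∈K)) x∈K)
            (*-closed (+-closed (*-closed p₂∈K (+-closed s∈K β₂∈K)) (*-closed t∈K q₂∈K)) y∈K)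

          e≈real+ω·imaginary :
            (m * (ω + s + β₁) + n * 0#) * x + (m * 0# + n * (ω + s + β₂)) * y ≈
            real + ω * imaginary
          e≈real+ω·imaginary = modulo (trans
            (lin (lin m≈ refl n≈ refl) refl (lin m≈ refl n≈ refl) refl)
            (solve 11 (λ w s t p₁ q₁ p₂ q₂ β₁ β₂ x y →
               ((p₁ :+ w :* q₁) :* (w :+ s :+ β₁) :+ (p₂ :+ w :* q₂) :* :0) :* x :+
               ((p₁ :+ w :* q₁) :* :0 :+ (p₂ :+ w :* q₂) :* (w :+ s :+ β₂)) :* y :=
               ((p₁ :* (s :+ β₁) :+ t :* q₁) :* x :+ (p₂ :* (s :+ β₂) :+ t :* q₂) :* y) :+
               w :* ((p₁ :+ q₁ :* β₁) :* x :+ (p₂ :+ q₂ :* β₂) :* y) :+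
               (w :* w :+ (t :+ w :* s)) :* (q₁ :* x :+ q₂ :* y))
               refl ω s t p₁ q₁ p₂ q₂ β₁ β₂ x y))
            (x≈y⇒x+y≈0 ω²≈t+ωs)

        row₁≈0 : d₁₁ * x + d₁₂ * y ≈ 0#
        row₁≈0 = row≈0 y₁₁≈ y₁₂≈ (proj₁ P∈K) (proj₁ Q∈K) e₁∈K

        row₂≈0 : d₂₁ * x + d₂₂ * y ≈ 0#
        row₂≈0 = row≈0 y₂₁≈ y₂₂≈ (proj₂ P∈K) (proj₂ Q∈K) e₂∈K

  generic-complement : ∀ {A A⁻} → A · A⁻ ≈ᵐ I₂ → ¬ A ≈ᵐ A⁻ → Complement A A⁻
  generic-complement {A} {mat y₁₁ y₁₂ y₂₁ y₂₂} AA⁻≈I A≉A⁻ =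
    let p₁₁ , q₁₁ , p₁₁∈K , q₁₁∈K , y₁₁≈ = F≈K+ωK y₁₁
        p₁₂ , q₁₂ , p₁₂∈K , q₁₂∈K , y₁₂≈ = F≈K+ωK y₁₂
        p₂₁ , q₂₁ , p₂₁∈K , q₂₁∈K , y₂₁≈ = F≈K+ωK y₂₁
        p₂₂ , q₂₂ , p₂₂∈K , q₂₂∈K , y₂₂≈ = F≈K+ωK y₂₂
        -- `t` and `s` are the norm and trace of `ω` over `K`.
        t , s , t∈K , s∈K , ω²≈t+ωs = F≈K+ωK (ω * ω)
        β₁ , β₂ , β₁∈K , β₂∈K , D≉0 = shiftedDet≉0 y₁₁≈ y₁₂≈ y₂₁≈ y₂₂≈ (det≉0 {A} AA⁻≈I)
        P∈K = (p₁₁∈K , p₁₂∈K) , (p₂₁∈K , p₂₂∈K)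
        Q∈K = (q₁₁∈K , q₁₂∈K) , (q₂₁∈K , q₂₂∈K)
    in record
      { M         = conjugate-diagonal s β₁ β₂
      ; disjoint  = diagonal-disjoint s∈K β₁∈K β₂∈K
      ; disjoint⁻ = product-disjoint y₁₁≈ y₁₂≈ y₂₁≈ y₂₂≈ s∈K t∈K ω²≈t+ωs P∈K Q∈K β₁∈K β₂∈K D≉0
      ; stable    = λ A≈A⁻ → contradiction A≈A⁻ A≉A⁻
      }

  -- Invariant complements for matrices with A² = I.

  balance : ∀ λ′ → ∃[ α ] ∃[ β ] ∃[ κ ] (α ∉ K × β ∉ K × κ ∈ K × λ′ * α + κ * β ≈ 0#)
  balance λ′ with K? λ′
  ... | yes λ∈K = ω , ω , λ′ , ω∉K , ω∉K , λ∈K , x+x≈0 (λ′ * ω)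
  -- The pair α = 1, β = λ′ fails because 1 ∈ K. Adding λ⁻¹ moves α out of `K`, and β = λ′ α = λ′ +
  -- 1.
  ... | no  λ∉K = 1# + λ⁻¹ , λ′ + 1# , 1# , 1+λ⁻¹∉K , λ+1∉K , 1-closed , (begin
    λ′ * (1# + λ⁻¹) + 1# * (λ′ + 1#)
      ≈⟨ solve 2 (λ x y → x :* (:1 :+ y) :+ :1 :* (x :+ :1) := x :* y :+ :1) refl λ′ λ⁻¹ ⟩
    λ′ * λ⁻¹ + 1#                    ≈⟨ x≈y⇒x+y≈0 λλ⁻¹≈1 ⟩
    0#                               ∎)
    where
    λ-inverse = invertible (λ λ≈0 → λ∉K (resp (sym λ≈0) 0-closed))
    λ⁻¹ = proj₁ λ-inverse
    λλ⁻¹≈1 = proj₂ (proj₂ λ-inverse)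

    1+λ⁻¹∉K : 1# + λ⁻¹ ∉ K
    1+λ⁻¹∉K 1+λ⁻¹∈K = λ∉K (inv-closed (+-cancel-∈ 1-closed 1+λ⁻¹∈K) (proj₁ (proj₂ λ-inverse)))

    λ+1∉K : λ′ + 1# ∉ K
    λ+1∉K λ+1∈K = λ∉K (+-cancel-∈ 1-closed (resp (+-comm λ′ 1#) λ+1∈K))

  InvariantComplement : Mat₂ → Set (c ⊔ ℓ)
  InvariantComplement A =
    ∃[ M ] (Disjoint M × ∀ {v} → v ∈ K² → A ·ᵛ (M ·ᵛ v) ∈ Image M)

  InvariantComplement-resp : ∀ {A B} → A ≈ᵐ B → InvariantComplement A → InvariantComplement B
  InvariantComplement-resp A≈B (M , disjoint , stable) =
    M , disjoint , λ v∈K² →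
      let u , u∈K² , Mu≈AMv = stable v∈K²
      in u , u∈K² , ≈ᵛ-trans Mu≈AMv (·ᵛ-cong A≈B ≈ᵛ-refl)

  -- `M K²` is K β (1, 0) + K α (0, 1). The shear fixes the first summand and moves α (0, 1) by b α
  -- (1, 0), which is κ β (1, 0) by `balance`.
  upper-invariant : ∀ b → InvariantComplement (mat 1# b 0# 1#)
  upper-invariant b =
    let α , β , κ , α∉K , β∉K , κ∈K , bα+κβ≈0 = balance b in
    mat 0# β α 0# ,
    (λ { {vec x y} (x∈K , y∈K) (p , q) → vec-≈
      (*-cancel-∉ α∉K x∈K (resp (dropʳ α x y) q))
      (*-cancel-∉ β∉K y∈K (resp (dropˡ β x y) p)) }) ,
    λ { {vec x y} (x∈K , y∈K) →
      vec x (y + κ * x) , (x∈K , +-closed y∈K (*-closed κ∈K x∈K)) , vec-≈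
        (modulo (solve 6 (λ b a β κ x y →
           :0 :* x :+ β :* (y :+ κ :* x) :=
           :1 :* (:0 :* x :+ β :* y) :+ b :* (a :* x :+ :0 :* y) :+ (b :* a :+ κ :* β) :* x)
           refl b α β κ x y) bα+κβ≈0)
        (solve 5 (λ a β κ x y →
           a :* x :+ :0 :* (y :+ κ :* x) :=
           :0 :* (:0 :* x :+ β :* y) :+ :1 :* (a :* x :+ :0 :* y))
           refl α β κ x y) }

  -- I + c N, where N has kernel and image spanned by (r, 1).
  transvection : Carrier → Carrier → Mat₂
  transvection c r = mat (1# + c * r) (c * r * r) c (1# + c * r)

  -- For r ∉ K the F-line through (r, 1) is itself a complement of K²;
  -- otherwise (r, 1) ∈ K², and the complement is K α (1, 0) + K β (r, 1).
  transvection-invariant : ∀ c r → InvariantComplement (transvection c r)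
  transvection-invariant c r with K? r
  ... | no r∉K =
    -- The columns (r, 1) and ω (r, 1) form a `K`-basis of the line, which is fixed pointwise.
    mat r (r * ω) 1# ω ,
    (λ { {vec x y} (x∈K , y∈K) (p , q) →
      let y≈0 = *-cancel-∉ ω∉K y∈K (+-cancel-∈ x∈K (resp (+-congʳ (*-identityˡ x)) q))
      in vec-≈
        (*-cancel-∉ r∉K x∈K (resp (modulo
          (solve 4 (λ r w x y → r :* x :+ r :* w :* y := r :* x :+ y :* (r :* w)) refl r ω x y)
          y≈0) p))
        y≈0 }) ,
    λ { {vec x y} v∈K² → vec x y , v∈K² , vec-≈
      (solve 5 (λ c r w x y →
         r :* x :+ r :* w :* y :=
         (:1 :+ c :* r) :* (r :* x :+ r :* w :* y) :+ c :* r :* r :* (:1 :* x :+ w :* y))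
         refl c r ω x y)
      (solve 5 (λ c r w x y →
         :1 :* x :+ w :* y :=
         c :* (r :* x :+ r :* w :* y) :+ (:1 :+ c :* r) :* (:1 :* x :+ w :* y))
         refl c r ω x y) }
  ... | yes r∈K =
    let α , β , κ , α∉K , β∉K , κ∈K , cα+κβ≈0 = balance c in
    mat α (β * r) 0# β ,
    (λ { {vec x y} (x∈K , y∈K) (p , q) →
      let y≈0 = *-cancel-∉ β∉K y∈K (resp (dropˡ β x y) q)
      in vec-≈
        (*-cancel-∉ α∉K x∈K (resp (modulo
          (solve 5 (λ a b r x y → a :* x :+ b :* r :* y := a :* x :+ y :* (b :* r)) refl α β r x y)
          y≈0) p))
        y≈0 }) ,
    λ { {vec x y} (x∈K , y∈K) →
      -- N maps (1, 0) to (r, 1), so α (1, 0) moves by c α (r, 1) = κ β (r, 1).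
      vec x (y + κ * x) , (x∈K , +-closed y∈K (*-closed κ∈K x∈K)) , vec-≈
        (modulo (solve 7 (λ c r a b κ x y →
           a :* x :+ b :* r :* (y :+ κ :* x) :=
           (:1 :+ c :* r) :* (a :* x :+ b :* r :* y) :+ c :* r :* r :* (:0 :* x :+ b :* y) :+
           (c :* a :+ κ :* b) :* (r :* x))
           refl c r α β κ x y) cα+κβ≈0)
        (modulo (solve 7 (λ c r a b κ x y →
           :0 :* x :+ b :* (y :+ κ :* x) :=
           c :* (a :* x :+ b :* r :* y) :+ (:1 :+ c :* r) :* (:0 :* x :+ b :* y) :+
           (c :* a :+ κ :* b) :* x)
           refl c r α β κ x y) cα+κβ≈0) }

  -- In characteristic 2, (a + d)² is the trace of A², here 1 + 1 = 0.
  involution-diagonal : ∀ {a b c d} → a * a + b * c ≈ 1# → c * b + d * d ≈ 1# → d ≈ a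
  involution-diagonal {a} {b} {c} {d} a²+bc≈1 cb+d²≈1 = x+y≈0⇒x≈y (square≈0 _≟_ (trans
    (solve 4 (λ a b c d →
       (d :+ a) :* (d :+ a) := (a :* a :+ b :* c) :+ (c :* b :+ d :* d)) refl a b c d)
    (trans (+-cong a²+bc≈1 cb+d²≈1) 1+1≈0)))

  -- An involution is an upper shear if its lower left entry vanishes, and otherwise a
  -- `transvection` with `r` determined by a = 1 + c r.
  involution-invariant : ∀ {A} → A · A ≈ᵐ I₂ → InvariantComplement A
  involution-invariant {mat a b c₀ d} (mat-≈ a²+bc≈1 _ _ cb+d²≈1) with c₀ ≟ 0#
  ... | yes c≈0 = InvariantComplement-resp
    (mat-≈ (sym a≈1) refl (sym c≈0)
           (trans (sym a≈1) (sym (involution-diagonal a²+bc≈1 cb+d²≈1))))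
    (upper-invariant b)
    where
    a≈1 : a ≈ 1#
    a≈1 = x+y≈0⇒x≈y (square≈0 _≟_ (trans
      (modulo (solve 3 (λ a b c →
         (a :+ :1) :* (a :+ :1) := (a :* a :+ b :* c :+ :1) :+ c :* b) refl a b c₀) c≈0)
      (x≈y⇒x+y≈0 a²+bc≈1)))
  ... | no c≉0 = InvariantComplement-resp
    (mat-≈ (sym a≈1+cr) (sym b≈cr²) refl
           (trans (sym a≈1+cr) (sym (involution-diagonal a²+bc≈1 cb+d²≈1))))
    (transvection-invariant c₀ r)
    where
    c⁻¹ = proj₁ (invertible c≉0)
    r = (a + 1#) * c⁻¹

    cc⁻¹+1≈0 : c₀ * c⁻¹ + 1# ≈ 0#
    cc⁻¹+1≈0 = x≈y⇒x+y≈0 (proj₂ (proj₂ (invertible c≉0)))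

    a≈1+cr : a ≈ 1# + c₀ * r
    a≈1+cr = modulo
      (solve 3 (λ a c i →
         a := (:1 :+ c :* ((a :+ :1) :* i)) :+ (c :* i :+ :1) :* (a :+ :1)) refl a c₀ c⁻¹)
      cc⁻¹+1≈0

    b≈cr² : b ≈ c₀ * r * r
    b≈cr² = modulo (modulo′ (x≈y⇒x+y≈0 a²+bc≈1)) cc⁻¹+1≈0
      where
      modulo′ : a * a + b * c₀ + 1# ≈ 0# →
                b ≈ c₀ * r * r + (c₀ * c⁻¹ + 1#) * (b + (a + 1#) * (a + 1#) * c⁻¹)
      modulo′ = modulo (solve 4 (λ a b c i →
        b := c :* ((a :+ :1) :* i) :* ((a :+ :1) :* i) :+
             (c :* i :+ :1) :* (b :+ (a :+ :1) :* (a :+ :1) :* i) :+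
             (a :* a :+ b :* c :+ :1) :* i) refl a b c₀ c⁻¹)

  -- If A M v ∈ K², then A M v = M u for some u ∈ K², so u = 0 and A M v = 0. Applying `A` once more
  -- gives M v = 0, whence v = 0.
  invariant⇒complement : ∀ {A A⁻} → A · A⁻ ≈ᵐ I₂ → A ≈ᵐ A⁻ → InvariantComplement A → Complement A A⁻
  invariant⇒complement {A} {A⁻} AA⁻≈I A≈A⁻ (M , disjoint , stable) = record
    { M         = M
    ; disjoint  = disjoint
    ; disjoint⁻ = Disjoint-resp (·-cong A≈A⁻ ≈ᵐ-refl) disjoint-AM
    ; stable    = λ _ → stable
    }
    where
    disjoint-AM : Disjoint (A · M)
    disjoint-AM {v} v∈K² AMv∈K² =
      let u , u∈K² , Mu≈AMv = stable v∈K²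
          A[Mv]∈K² = K²-resp (·ᵛ-assoc A M v) AMv∈K²
          u≈0 = disjoint u∈K² (K²-resp (≈ᵛ-sym Mu≈AMv) A[Mv]∈K²)
          AMv≈0 = ≈ᵛ-trans (≈ᵛ-sym Mu≈AMv) (≈ᵛ-trans (·ᵛ-cong (≈ᵐ-refl {M}) u≈0) (·ᵛ-0 M))
          Mv≈0 = ≈ᵛ-trans (≈ᵛ-sym (·ᵛ-identity (M ·ᵛ v)))
                 (≈ᵛ-trans (·ᵛ-cong (≈ᵐ-sym (≈ᵐ-trans (·-cong (≈ᵐ-refl {A}) A≈A⁻) AA⁻≈I)) ≈ᵛ-refl)
                 (≈ᵛ-trans (·ᵛ-assoc A A (M ·ᵛ v))
                 (≈ᵛ-trans (·ᵛ-cong (≈ᵐ-refl {A}) AMv≈0) (·ᵛ-0 A))))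
      in disjoint v∈K² (K²-resp (≈ᵛ-sym Mv≈0) (0-closed , 0-closed))

  -- A choice of complements that respects equality of matrices.

  _≟ᵐ_ : Decidable _≈ᵐ_
  mat a b c d ≟ᵐ mat a′ b′ c′ d′ =
    map′ (λ { ((p , q) , (r , s)) → mat-≈ p q r s }) (λ { (mat-≈ p q r s) → (p , q) , (r , s) })
         (((a ≟ a′) ×-dec (b ≟ b′)) ×-dec ((c ≟ c′) ×-dec (d ≟ d′)))

  abstract
    complement : ∀ A A⁻ → A · A⁻ ≈ᵐ I₂ → Complement A A⁻
    complement A A⁻ AA⁻≈I with A ≟ᵐ A⁻
    ... | yes A≈A⁻ = invariant⇒complement AA⁻≈I A≈A⁻
      (involution-invariant (≈ᵐ-trans (·-cong (≈ᵐ-refl {A}) A≈A⁻) AA⁻≈I))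
    ... | no  A≉A⁻ = generic-complement {A} AA⁻≈I A≉A⁻

    -- Irrelevance of the certificate makes the chosen complement depend on the
    -- two matrices only.
    canonicalComplement : ∀ A A⁻ → .(A · A⁻ ≈ᵐ I₂) → Complement A A⁻
    canonicalComplement A A⁻ AA⁻≈I = complement A A⁻ (recompute ((A · A⁻) ≟ᵐ I₂) AA⁻≈I)

  repᵐ : Mat₂ → Mat₂
  repᵐ (mat a b c d) = mat (rep a) (rep b) (rep c) (rep d)

  repᵐ≈ : ∀ A → repᵐ A ≈ᵐ A
  repᵐ≈ (mat a b c d) = mat-≈ (to-index a) (to-index b) (to-index c) (to-index d)

  repᵐ-cong : ∀ {A B} → A ≈ᵐ B → repᵐ A ≡ repᵐ B
  repᵐ-cong (mat-≈ p q r s)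
    rewrite rep-cong p | rep-cong q | rep-cong r | rep-cong s = ≡.refl

  -- Provides a total order on matrices, used to single out one of `A` and `A⁻¹`.
  code : Mat₂ → Fin _
  code (mat a b c d) = combine (combine (index a) (index b)) (combine (index c) (index d))

  code-cong : ∀ {A B} → A ≈ᵐ B → code A ≡ code B
  code-cong (mat-≈ p q r s)
    rewrite index-cong p | index-cong q | index-cong r | index-cong s = ≡.refl

  code-injective : ∀ {A B} → code A ≡ code B → A ≈ᵐ B
  code-injective {mat a b c d} {mat a′ b′ c′ d′} eq =
    let ab , cd = combine-injective (combine (index a) (index b)) (combine (index c) (index d))
                    (combine (index a′) (index b′)) (combine (index c′) (index d′)) eq
        p , q = combine-injective (index a) (index b) (index a′) (index b′) ab
        r , s = combine-injective (index c) (index d) (index c′) (index d′) cd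
    in mat-≈ (index-injective p) (index-injective q) (index-injective r) (index-injective s)

  repᵐ-inverse : ∀ A → repᵐ (matrix A) · repᵐ (inverseMatrix A) ≈ᵐ I₂
  repᵐ-inverse (gl A (A⁻ , _ , AA⁻≈I)) = ≈ᵐ-trans (·-cong (repᵐ≈ A) (repᵐ≈ A⁻)) AA⁻≈I

  complementOf : (A : GL₂) → Complement (repᵐ (matrix A)) (repᵐ (inverseMatrix A))
  complementOf A = canonicalComplement _ _ (repᵐ-inverse A)

  module _ (A : GL₂) where
    open Complement (complementOf A) public
      using () renaming (M to basis; disjoint to basis-disjoint)

  basis-cong : ∀ A B → matrix A ≈ᵐ matrix B → basis A ≡ basis B
  basis-cong A B A≈B = cong-canonical (repᵐ-cong A≈B) (repᵐ-cong (inverse-unique A B A≈B))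
    where
    cong-canonical : ∀ {X Y X⁻ Y⁻} → X ≡ Y → X⁻ ≡ Y⁻ →
      .{p : X · X⁻ ≈ᵐ I₂} → .{q : Y · Y⁻ ≈ᵐ I₂} →
      Complement.M (canonicalComplement X X⁻ p) ≡ Complement.M (canonicalComplement Y Y⁻ q)
    cong-canonical ≡.refl ≡.refl = ≡.refl

  Image-resp : ∀ {M} → Image M Respects _≈ᵛ_
  Image-resp v≈w (u , u∈K² , Mu≈v) = u , u∈K² , ≈ᵛ-trans Mu≈v v≈w

  -- Sections compatible with inversion.

  _≤⁻¹ : GL₂ → Set
  A ≤⁻¹ = code (matrix A) ≤ code (inverseMatrix A)

  ≤⁻¹-resp : ∀ A B → matrix A ≈ᵐ matrix B → A ≤⁻¹ → B ≤⁻¹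
  ≤⁻¹-resp A B A≈B = ≡.subst₂ _≤_ (code-cong A≈B) (code-cong (inverse-unique A B A≈B))

  abstract
    _≤⁻¹? : ∀ A → Dec (A ≤⁻¹)
    A ≤⁻¹? = code (matrix A) ≤ᶠ? code (inverseMatrix A)

  -- Of A and A⁻¹, the one with the smaller code gets the image of its basis,
  -- and the other one the corresponding image under inversion in AGL₂.
  SectionBy : ∀ {P : Set} → Dec P → GL₂ → Pred Vec₂ (c ⊔ ℓ)
  SectionBy (yes _) A a = Image (basis A) a
  SectionBy (no  _) A a = Image (basis (inv-GL A)) (inverseMatrix A ·ᵛ a)

  Section : GL₂ → Pred Vec₂ (c ⊔ ℓ)
  Section A = SectionBy (A ≤⁻¹?) A

  Section-resp : ∀ A B {a b} → matrix A ≈ᵐ matrix B → a ≈ᵛ b → Section A a → Section B b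
  Section-resp A B {a} {b} A≈B a≈b = by (A ≤⁻¹?) (B ≤⁻¹?)
    where
    A⁻≈B⁻ = inverse-unique A B A≈B

    by : (d : Dec (A ≤⁻¹)) (e : Dec (B ≤⁻¹)) → SectionBy d A a → SectionBy e B b
    by (yes _) (yes _) a∈A =
      ≡.subst (λ M → Image M b) (basis-cong A B A≈B) (Image-resp a≈b a∈A)
    by (no _)  (no _)  a∈A =
      ≡.subst (λ M → Image M (inverseMatrix B ·ᵛ b)) (basis-cong (inv-GL A) (inv-GL B) A⁻≈B⁻)
        (Image-resp (·ᵛ-cong A⁻≈B⁻ a≈b) a∈A)
    by (yes A≤) (no B≰) _ = contradiction (≤⁻¹-resp A B A≈B A≤) B≰
    by (no A≰) (yes B≤) _ = contradiction (≤⁻¹-resp B A (≈ᵐ-sym A≈B) B≤) A≰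

  Section-inverse : ∀ A {a} → Section A a → Section (inv-GL A) (inverseMatrix A ·ᵛ a)
  Section-inverse A@(gl X (X⁻ , X⁻X≈I , XX⁻≈I)) {a} = by (A ≤⁻¹?) (inv-GL A ≤⁻¹?)
    where
    by : (d : Dec (A ≤⁻¹)) (e : Dec (inv-GL A ≤⁻¹)) →
         SectionBy d A a → SectionBy e (inv-GL A) (X⁻ ·ᵛ a)
    by (no _)  (yes _)  a∈A = a∈A
    by (yes _) (no _)   a∈A =
      Image-resp (≈ᵛ-sym (≈ᵛ-trans (≈ᵛ-sym (·ᵛ-assoc X X⁻ a))
                         (≈ᵛ-trans (·ᵛ-cong XX⁻≈I ≈ᵛ-refl) (·ᵛ-identity a)))) a∈A
    by (no X≰) (no X⁻≰) _ with ≤ᶠ-total (code X) (code X⁻)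
    ... | inj₁ X≤X⁻ = contradiction X≤X⁻ X≰
    ... | inj₂ X⁻≤X = contradiction X⁻≤X X⁻≰
    -- Equal codes mean X = X⁻, the case in which `stable` is needed.
    by (yes X≤X⁻) (yes X⁻≤X) (u , u∈K² , Mu≈a) =
      ≡.subst (λ M → Image M (X⁻ ·ᵛ a)) (basis-cong A (inv-GL A) X≈X⁻)
        (Image-resp
          (·ᵛ-cong (≈ᵐ-trans (repᵐ≈ X) X≈X⁻) Mu≈a)
          (Complement.stable (complementOf A)
            (≈ᵐ-trans (repᵐ≈ X) (≈ᵐ-trans X≈X⁻ (≈ᵐ-sym (repᵐ≈ X⁻)))) u∈K²))
      where
      X≈X⁻ : X ≈ᵐ X⁻
      X≈X⁻ = code-injective (≤ᶠ-antisym X≤X⁻ X⁻≤X)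

  -- When the basis M′ was chosen for the inverse, the section at `A` is A M′ K², a complement by
  -- `disjoint⁻` at the inverse.
  Section-transversal : ∀ A a → ∃! _≈ᵛ_ λ b → b ∈ K² × Section A (b +ᵛ a)
  Section-transversal A a = by (A ≤⁻¹?)
    where
    M′ = basis (inv-GL A)

    disjoint⁻′ : Disjoint (matrix A · M′)
    disjoint⁻′ = Disjoint-resp (·-cong (repᵐ≈ (matrix A)) ≈ᵐ-refl)
                   (Complement.disjoint⁻ (complementOf (inv-GL A)))

    to-inverse : ∀ {v} → Image (matrix A · M′) v → Image M′ (inverseMatrix A ·ᵛ v)
    to-inverse {v} (u , u∈K² , eq) = u , u∈K² ,
      ≈ᵛ-trans (≈ᵛ-sym (·ᵛ-identity (M′ ·ᵛ u)))
      (≈ᵛ-trans (·ᵛ-cong (≈ᵐ-sym (proj₁ (proj₂ (GL₂.invertible₂ A)))) ≈ᵛ-refl)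
      (≈ᵛ-trans (·ᵛ-assoc (inverseMatrix A) (matrix A) (M′ ·ᵛ u))
      (·ᵛ-cong ≈ᵐ-refl (≈ᵛ-trans (≈ᵛ-sym (·ᵛ-assoc (matrix A) M′ u)) eq))))

    from-inverse : ∀ {v} → Image M′ (inverseMatrix A ·ᵛ v) → Image (matrix A · M′) v
    from-inverse {v} (u , u∈K² , eq) = u , u∈K² ,
      ≈ᵛ-trans (·ᵛ-assoc (matrix A) M′ u)
      (≈ᵛ-trans (·ᵛ-cong ≈ᵐ-refl eq)
      (≈ᵛ-trans (≈ᵛ-sym (·ᵛ-assoc (matrix A) (inverseMatrix A) v))
      (≈ᵛ-trans (·ᵛ-cong (proj₂ (proj₂ (GL₂.invertible₂ A))) ≈ᵛ-refl) (·ᵛ-identity v))))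

    pull : ∃! _≈ᵛ_ (λ b → b ∈ K² × b +ᵛ a ∈ Image (matrix A · M′)) →
           ∃! _≈ᵛ_ λ b → b ∈ K² × Image M′ (inverseMatrix A ·ᵛ (b +ᵛ a))
    pull (b , (b∈K² , b+a∈) , unique) =
      b , (b∈K² , to-inverse b+a∈) , λ { (b′∈K² , b′+a∈) → unique (b′∈K² , from-inverse b′+a∈) }

    by : (d : Dec (A ≤⁻¹)) → ∃! _≈ᵛ_ λ b → b ∈ K² × SectionBy d A (b +ᵛ a)
    by (yes _) = disjoint⇒transversal {basis A} (basis-disjoint A) a
    by (no  _) = pull (disjoint⇒transversal {matrix A · M′} disjoint⁻′ a)

  -- The inverse-closed transversal in the affine group.

  open Group (Affine.AGL₂ F) using (_∙_; _⁻¹)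

  private
    Transversal : Pred AffineMap (c ⊔ ℓ)
    Transversal (a ,, A) = Section A a

    Transversal-resp : Transversal Respects _≈ᵃ_
    Transversal-resp {_ ,, A} {_ ,, B} (aff-≈ a≈b A≈B) = Section-resp A B A≈B a≈b

    Transversal-inverse : ∀ g → g ∈ Transversal → g ⁻¹ ∈ Transversal
    Transversal-inverse (a ,, A) a∈A =
      Section-resp (inv-GL A) (inv-GL A) ≈ᵐ-refl (v≈-v (inverseMatrix A ·ᵛ a))
        (Section-inverse A a∈A)
      where
      v≈-v : ∀ v → v ≈ᵛ -ᵛ v
      v≈-v (vec x y) = vec-≈ (x≈-x x) (x≈-x y)
        where
        x≈-x : ∀ x → x ≈ - x
        x≈-x x = trans (+-move (-‿inverseʳ x)) (+-identityˡ (- x))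

    -- Left multiplication by a translation keeps the linear part and adds to the translation part,
    -- so only the section at `A` matters.
    Transversal-transversal : ∀ g →
      ∃! _≈ᵃ_ λ h → h ∈ Affine.Translations F K × h ∙ g ∈ Transversal
    Transversal-transversal (a ,, A) = lift (Section-transversal A a)
      where
      open Affine.Translations
      lift : (∃! _≈ᵛ_ λ b → b ∈ K² × Section A (b +ᵛ a)) →
             ∃! _≈ᵃ_ λ h → h ∈ Affine.Translations F K × h ∙ (a ,, A) ∈ Transversal
      lift (b , (b∈K² , b+a∈A) , unique) =
        (b ,, I-GL)
        , ( record { entry₁ = proj₁ b∈K² ; entry₂ = proj₂ b∈K² ; linear-I = ≈ᵐ-refl }
          , Section-resp A (I-GL ·ᵍ A) (≈ᵐ-sym (·-identityˡ (matrix A)))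
              (+ᵛ-cong (≈ᵛ-refl {b}) (≈ᵛ-sym (·ᵛ-identity a))) b+a∈A)
        , λ { {b′ ,, B} (h∈H , hg∈T) → aff-≈
            (unique ((entry₁ h∈H , entry₂ h∈H) ,
              Section-resp (B ·ᵍ A) A
                (≈ᵐ-trans (·-cong (linear-I h∈H) ≈ᵐ-refl) (·-identityˡ (matrix A)))
                (+ᵛ-cong (≈ᵛ-refl {b′}) (≈ᵛ-trans (·ᵛ-cong (linear-I h∈H) ≈ᵛ-refl) (·ᵛ-identity a)))
                hg∈T))
            (≈ᵐ-sym (linear-I h∈H)) }

  translations-perfectCode : IsPerfectCodeOfGroup (Affine.AGL₂ F) (Affine.Translations F K)
  translations-perfectCode =
    inverseClosedTransversal⇒perfectCode (Affine.AGL₂ F) (Affine.Translations F K) Transversal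
      (translations-subgroup F K≤F) Transversal-resp
      (λ {g} → Transversal-inverse g) Transversal-transversal

-- Replacing the subfield by its enumeration.

module _ (F : Field c ℓ) {K : Pred (Field.Carrier F) k} (K≤F : IsSubfield F K)
         {q : ℕ} (K-order : HasOrder (subsetoid (Field.setoid F) K) q) where

  open Field F
  open Bijection K-order using (to; injective)

  private
    module KE = Enumerated (subsetoid setoid K) K-order

  -- K itself need be neither decidable nor small enough for a connection set.
  Enumerated-∈ : Pred Carrier ℓ
  Enumerated-∈ x = ∃[ i ] proj₁ (to i) ≈ x

  ∈⇒enumerated : K ⊆ Enumerated-∈
  ∈⇒enumerated x∈K = KE.index (_ , x∈K) , KE.to-index (_ , x∈K)

  enumerated⇒∈ : Enumerated-∈ ⊆ K
  enumerated⇒∈ (i , eq) = IsSubfield.resp K≤F eq (proj₂ (to i))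

  enumerated-subfield : IsSubfield F Enumerated-∈
  enumerated-subfield = record
    { resp       = λ { x≈y (i , eq) → i , trans eq x≈y }
    ; 0-closed   = ∈⇒enumerated 0-closed
    ; 1-closed   = ∈⇒enumerated 1-closed
    ; +-closed   = λ x∈ y∈ → ∈⇒enumerated (+-closed (enumerated⇒∈ x∈) (enumerated⇒∈ y∈))
    ; neg-closed = λ x∈ → ∈⇒enumerated (neg-closed (enumerated⇒∈ x∈))
    ; *-closed   = λ x∈ y∈ → ∈⇒enumerated (*-closed (enumerated⇒∈ x∈) (enumerated⇒∈ y∈))
    ; inv-closed = λ x∈ xy≈1 → ∈⇒enumerated (inv-closed (enumerated⇒∈ x∈) xy≈1)
    }
    where open IsSubfield K≤F

  enumerated-order : HasOrder (subsetoid setoid Enumerated-∈) q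
  enumerated-order = record
    { to        = λ i → proj₁ (to i) , i , refl
    ; cong      = λ { ≡.refl → refl }
    ; bijective = injective , λ { (_ , i , eq) → i , λ { ≡.refl → eq } }
    }

  enumerated? : Decidable _≈_ → Unary.Decidable Enumerated-∈
  enumerated? _≟_ x = any? (λ i → proj₁ (to i) ≟ x)

  -- If all elements of `F` were listed, their positions in the list would inject `Fin m` into
  -- `Fin q`.
  ∃∉ : ∀ {m} → q ℕ.< m → HasOrder setoid m → ∃[ x ] x ∉ Enumerated-∈
  ∃∉ {m} q<m F-order =
    let i , ∉K = ¬∀⟶∃¬ m (λ i → FB.to i ∈ Enumerated-∈) (λ i → enumerated? FE._≟_ (FB.to i)) ¬all
    in FB.to i , ∉K
    where
    module FB = Bijection F-order
    module FE = Enumerated setoid F-order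

    ¬all : ¬ (∀ i → FB.to i ∈ Enumerated-∈)
    ¬all all = ℕ.<⇒≱ q<m (injective⇒≤ {f = proj₁ ∘ all} λ {i} {j} eq →
      FB.injective (trans (sym (proj₂ (all i)))
        (trans (reflexive (≡.cong (proj₁ ∘ to) eq)) (proj₂ (all j)))))

-- The four claims for orders q and q² with q = 2^n.

theorem1p3 : ∀ {c ℓ k : Level} (n : ℕ) → n ≥ 1 →
    let q = 2 ^ n in
    (F : Field c ℓ) → HasOrder (Field.setoid F) (q ^ 2) →
    (K : Pred (Field.Carrier F) k) → IsSubfield F K →
    HasOrder (subsetoid (Field.setoid F) K) q →
    let G = Affine.AGL₂ F
        H = Affine.Translations F K
    in IsSubgroup G H × ¬ IsNormal G H × IsPerfectCodeOfGroup G H × ¬ Φ G H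
theorem1p3 n n≥1 F F-order K K≤F K-order =
  let perfect′ = Complements.translations-perfectCode F (enumerated-subfield F K≤F K-order)
        (enumerated? F K≤F K-order _≟_) F-order′ (enumerated-order F K≤F K-order)
        1+1≈0 (proj₂ ω,ω∉K)
      perfect = perfectCode-resp (Affine.AGL₂ F)
        {Affine.Translations F (Enumerated-∈ F K≤F K-order)} {Affine.Translations F K}
        (Translations-⊆ (enumerated⇒∈ F K≤F K-order))
        (Translations-⊆ (∈⇒enumerated F K≤F K-order))
        perfect′
  in translations-subgroup F K≤F , translations-not-normal F K≤F ω∉K
   , perfect , ¬Φ-translations F K≤F ω∉K 1+1≈0
  where
  open Field F
  open Enumerated setoid F-order using (_≟_)
  open Mult semiring using () renaming (_×_ to _×′_)

  q = 2 ^ n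

  F-order′ : HasOrder setoid (q ℕ.* q)
  F-order′ = ≡.subst (HasOrder setoid) (≡.cong (q ℕ.*_) (ℕ.*-identityʳ q)) F-order

  1+1≈0 : 1# + 1# ≈ 0#
  1+1≈0 = FieldProperties.2^n×1≈0⇒1+1≈0 F _≟_ (n ℕ.* 2)
    (≡.subst (λ m → m ×′ 1# ≈ 0#) (ℕ.^-*-assoc 2 n 2) (order×1≈0 commutativeRing F-order))

  q<q*q : q ℕ.< q ℕ.* q
  -- `n ≥ 1` gives 1 < q, so `F` is strictly larger than `K` and contains some `ω ∉ K`.
  q<q*q = ℕ.m<m*n q q {{ℕ.m^n≢0 2 n}} (ℕ.^-monoʳ-< 2 (ℕ.s≤s (ℕ.s≤s ℕ.z≤n)) n≥1)

  ω,ω∉K = ∃∉ F K≤F K-order q<q*q F-order′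

  ω∉K : proj₁ ω,ω∉K ∉ K
  ω∉K = proj₂ ω,ω∉K ∘ ∈⇒enumerated F K≤F K-order

  Translations-⊆ : ∀ {p p′} {P : Pred Carrier p} {P′ : Pred Carrier p′} → P ⊆ P′ →
                   Affine.Translations F P ⊆ Affine.Translations F P′
  Translations-⊆ P⊆P′ g∈H = record
    { entry₁ = P⊆P′ entry₁ ; entry₂ = P⊆P′ entry₂ ; linear-I = linear-I }
    where open Affine.Translations g∈H
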